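{- Let $\mathcal{K}$ be a class of geometric objects in the plane such that the Maximum Independent Set problem is NP-complete on the intersection graphs of finite collections of objects from $\mathcal{K}$. Then the Maximum Bipartite Subgraph problem is NP-complete on the intersection graphs of finite collections of objects from $\mathcal{K}$.
   Context: The intersection graph of a finite collection of geometric objects has one vertex per object, two vertices being adjacent if and only if the corresponding objects intersect. Collections may contain the same object more than once in the same position (such copies are distinct, mutually adjacent vertices). Instances are given by the geometric objects. The Maximum Independent Set (decision) problem asks, given the collection and an integer $k$, whether the intersection graph has an independent set of size at least $k$. The Maximum Bipartite Subgraph (decision) problem asks, given the collection and an integer $k$, whether there is a subcollection of at least $k$ objects whose intersection graph is bipartite. -}

module Defs where

open import Data.Bool using (Bool; true; false)
open import Data.Fin using (Fin)
open import Data.Fin.Subset as Subset using (Subset)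
open import Data.Integer using (+_)
open import Data.List using (List; []; _∷_; [_]; _++_; map; concatMap; length; lookup)
open import Data.List.Relation.Binary.Sublist.Propositional using (_⊆_)
open import Data.Maybe using (Maybe; just; nothing; maybe′)
open import Data.Nat using (ℕ; zero; suc; _+_; _*_; _≤_)
open import Data.Product using (Σ; ∃-syntax; _×_; _,_; proj₁)
open import Data.Product.Relation.Binary.Pointwise.NonDependent using (Pointwise)
open import Data.Rational as ℚ using (ℚ)
open import Data.Vec as Vec using (Vec; []; _∷_)
open import Function using (_∘_; _⇔_)
open import Level using (0ℓ)
open import Relation.Binary using (Rel; Symmetric; Irreflexive; _Respects_)
open import Relation.Binary.PropositionalEquality using (_≡_; _≢_; sym)
open import Relation.Nullary using (¬_)
open import Relation.Unary using (Pred; Satisfiable; _≬_)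

------------------------------------------------------------------------
-- Polynomials with natural-number coefficients, in one variable

data Polynomial : Set where
  con       : ℕ → Polynomial
  var       : Polynomial
  _:+_ _:*_ : Polynomial → Polynomial → Polynomial

⟦_⟧ : Polynomial → ℕ → ℕ
⟦ con a  ⟧ n = a
⟦ var    ⟧ n = n
⟦ p :+ q ⟧ n = ⟦ p ⟧ n + ⟦ q ⟧ n
⟦ p :* q ⟧ n = ⟦ p ⟧ n * ⟦ q ⟧ n

------------------------------------------------------------------------
-- Words and languages

-- The input alphabet {0, 1, #}.
data Symbol : Set where
  bit : Bool → Symbol
  sep : Symbol

Word : Set
Word = List Symbol

Language : Set₁
Language = Pred Word 0ℓ

------------------------------------------------------------------------
-- Deterministic multi-tape Turing machines

-- The tape alphabet: blank, the input symbols, and w further symbols.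
data Cell (w : ℕ) : Set where
  blank : Cell w
  input : Symbol → Cell w
  work  : Fin w → Cell w

data Move : Set where
  left stay right : Move

-- A two-way infinite tape.  All cells beyond the two lists are blank, and
-- both lists start with the cell nearest to the head.
record Tape (w : ℕ) : Set where
  constructor tape
  field
    before : List (Cell w)
    head   : Cell w
    after  : List (Cell w)

module _ {w : ℕ} where

  emptyTape : Tape w
  emptyTape = tape [] blank []

  loadTape : Word → Tape w
  loadTape []      = emptyTape
  loadTape (a ∷ u) = tape [] (input a) (map input u)

  moveHead : Move → Tape w → Tape w
  moveHead left  (tape []       a rs)       = tape [] blank (a ∷ rs)
  moveHead left  (tape (l ∷ ls) a rs)       = tape ls l (a ∷ rs)
  moveHead stay  t                          = t
  moveHead right (tape ls       a [])       = tape (a ∷ ls) blank []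
  moveHead right (tape ls       a (r ∷ rs)) = tape (a ∷ ls) r rs

  act : Cell w × Move → Tape w → Tape w
  act (b , m) (tape ls _ rs) = moveHead m (tape ls b rs)

  inputPrefix : List (Cell w) → Word
  inputPrefix (input a ∷ cs) = a ∷ inputPrefix cs
  inputPrefix _              = []

  -- The word written from the head rightwards, up to the first cell that
  -- does not hold an input symbol.
  readTape : Tape w → Word
  readTape (tape _ a rs) = inputPrefix (a ∷ rs)

-- Tape 0 holds the input.  Tape 1 initially holds the certificate if the
-- machine is used as a verifier; if it is used to compute a function, tape 1
-- is initially empty and finally holds the output.
record TuringMachine : Set where
  field
    workSymbols : ℕ
    extraTapes  : ℕ
    states      : ℕ

  State : Set
  State = Fin states

  tapes : ℕ
  tapes = 2 + extraTapes

  field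
    start     : State
    accepting : State → Bool
    -- The machine halts where the transition function is undefined.
    δ : State → Vec (Cell workSymbols) tapes →
        Maybe (State × Vec (Cell workSymbols × Move) tapes)

  Configuration : Set
  Configuration = State × Vec (Tape workSymbols) tapes

  initial : Word → Word → Configuration
  initial u v =
    start , loadTape u ∷ loadTape v ∷ Vec.replicate extraTapes emptyTape

  step : Configuration → Maybe Configuration
  step (q , ts) = maybe′
    (λ { (q′ , as) → just (q′ , Vec.zipWith act as ts) })
    nothing
    (δ q (Vec.map Tape.head ts))

  -- The configuration after n steps, or the halting configuration if the
  -- machine halts earlier.
  run : ℕ → Configuration → Configuration
  run zero    c = c
  run (suc n) c = maybe′ (run n) c (step c)

  Halted : Pred Configuration 0ℓ
  Halted c = step c ≡ nothing

  Accepting : Pred Configuration 0ℓ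
  Accepting (q , _) = accepting q ≡ true

  output : Configuration → Word
  output (_ , _ ∷ t ∷ _) = readTape t

------------------------------------------------------------------------
-- NP-completeness

record PolynomialTimeComputable (f : Word → Word) : Set where
  field
    machine : TuringMachine
    time    : Polynomial
  open TuringMachine machine
  final : Word → Configuration
  final x = run (⟦ time ⟧ (length x)) (initial x [])
  field
    halts    : ∀ x → Halted (final x)
    computes : ∀ x → output (final x) ≡ f x

infix 4 _≤ₚ_

-- Polynomial-time many-one reducibility.
_≤ₚ_ : Language → Language → Set
L ≤ₚ L′ = ∃[ f ] PolynomialTimeComputable f × (∀ x → L x ⇔ L′ (f x))

record InNP (L : Language) : Set where
  field
    verifier          : TuringMachine
    time              : Polynomial
    certificateLength : Polynomial
  open TuringMachine verifier
  final : Word → Word → Configuration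
  final x c = run (⟦ time ⟧ (length x + length c)) (initial x c)
  field
    halts   : ∀ x c → Halted (final x c)
    correct : ∀ x →
      L x ⇔ (∃[ c ] length c ≤ ⟦ certificateLength ⟧ (length x) ×
                    Accepting (final x c))

NPHard : Language → Set₁
NPHard L = ∀ L′ → InNP L′ → L′ ≤ₚ L

NPComplete : Language → Set₁
NPComplete L = InNP L × NPHard L

------------------------------------------------------------------------
-- Finite simple graphs

record Graph : Set₁ where
  field
    vertices    : ℕ
    Adjacent    : Rel (Fin vertices) 0ℓ
    symmetric   : Symmetric Adjacent
    irreflexive : Irreflexive _≡_ Adjacent

module _ (G : Graph) where
  open Graph G

  Independent : Pred (Subset vertices) 0ℓ
  Independent S = ∀ {i j} → i Subset.∈ S → j Subset.∈ S → ¬ Adjacent i j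

  Bipartite : Set
  Bipartite = Σ (Fin vertices → Bool) λ side →
    ∀ {i j} → Adjacent i j → side i ≢ side j

------------------------------------------------------------------------
-- The plane

-- Bishop's real numbers: approx n is within 1/(n+1) of the number.
record ℝ : Set where
  field
    approx  : ℕ → ℚ
    regular : ∀ m n →
      ℚ.∣ approx m ℚ.- approx n ∣ ℚ.≤ (+ 1 ℚ./ suc m) ℚ.+ (+ 1 ℚ./ suc n)

_≃_ : Rel ℝ 0ℓ
x ≃ y = ∀ n → ℚ.∣ ℝ.approx x n ℚ.- ℝ.approx y n ∣ ℚ.≤ (+ 2 ℚ./ suc n)

Plane : Set
Plane = ℝ × ℝ

_≃ₚ_ : Rel Plane 0ℓ
_≃ₚ_ = Pointwise _≃_ _≃_

------------------------------------------------------------------------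
-- Classes of geometric objects and their intersection graphs

-- An object is a nonempty set of points of the plane, given to algorithms by
-- a bit string that determines the object.  Nonemptiness is what makes two
-- copies of an object intersect.
record GeometricClass : Set₁ where
  field
    Object         : Set
    region         : Object → Pred Plane 0ℓ
    region-resp    : ∀ o → region o Respects _≃ₚ_
    nonempty       : ∀ o → Satisfiable (region o)
    code           : Object → List Bool
    code-injective : ∀ {o o′} → code o ≡ code o′ → o ≡ o′

-- Least significant bit first, without superfluous zeros; in particular 0 is
-- the empty string.
increment : List Bool → List Bool
increment []           = [ true ]
increment (false ∷ bs) = true ∷ bs
increment (true  ∷ bs) = false ∷ increment bs

binary : ℕ → List Bool
binary zero    = []
binary (suc n) = increment (binary n)

module _ (K : GeometricClass) where
  open GeometricClass K

  -- A finite collection, possibly with repetitions.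
  Collection : Set
  Collection = List Object

  intersectionGraph : Collection → Graph
  intersectionGraph os = record
    { vertices    = length os
    ; Adjacent    = λ i j → i ≢ j × (region (lookup os i) ≬ region (lookup os j))
    ; symmetric   = λ { (i≢j , p , p∈i , p∈j) → i≢j ∘ sym , p , p∈j , p∈i }
    ; irreflexive = λ i≡j adj → proj₁ adj i≡j
    }

  -- The word  k # o₁ # o₂ # … oₙ #
  encode : Collection × ℕ → Word
  encode (os , k) =
    map bit (binary k) ++ sep ∷ concatMap (λ o → map bit (code o) ++ [ sep ]) os

  language : Pred (Collection × ℕ) 0ℓ → Language
  language P x = ∃[ I ] encode I ≡ x × P I

  HasIndependentSet : Pred (Collection × ℕ) 0ℓ
  HasIndependentSet (os , k) =
    ∃[ S ] Independent (intersectionGraph os) S × k ≤ Subset.∣ S ∣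

  HasBipartiteSubcollection : Pred (Collection × ℕ) 0ℓ
  HasBipartiteSubcollection (os , k) =
    ∃[ os′ ] os′ ⊆ os × k ≤ length os′ × Bipartite (intersectionGraph os′)

  MaximumIndependentSet : Language
  MaximumIndependentSet = language HasIndependentSet

  MaximumBipartiteSubgraph : Language
  MaximumBipartiteSubgraph = language HasBipartiteSubcollection

{-# OPTIONS --safe #-}

-- For hardness, send (os , k) to (os ++ os , k + k).  An independent set taken
-- in both copies induces a bipartite graph; conversely one of the two colour
-- classes of a bipartite subcollection has at least k objects, and since every
-- object meets its copies, these occupy distinct positions of os.
--
-- For membership, (os , k) has a bipartite subcollection iff os splits into two
-- collections and k into two summands such that both pairs are yes-instances
-- of Maximum Independent Set.  A certificate describes the two splittings and
-- contains a certificate for each of the two instances, which the given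
-- verifier then checks.  That verifier may accept certificates that are too
-- long, so the length has to be checked against a polynomial first; a loop
-- nest over copies of the instance counts up to its value.
module Submission where

open import Data.Bool using (Bool; true; false; if_then_else_; not; _∧_; _∨_; _xor_)
open import Data.Bool.Properties using (∧-conicalˡ; ∧-conicalʳ; T-≡)
open import Data.Empty using (⊥-elim)
open import Data.Fin using (Fin; zero; suc)
import Data.Fin.Properties as Finₚ
open import Data.Fin.Subset as Subset using (Subset; inside; outside)
open import Data.List as List using (List; []; _∷_; [_]; _++_; map; concatMap; length; lookup; replicate; reverse; _ʳ++_)
open import Data.List.Membership.Propositional using (_∈_)
open import Data.List.Membership.Propositional.Properties using (∈-map⁺; ∈-++⁺ˡ; ∈-++⁺ʳ; ∈-concatMap⁺; ∈-allFin)
open import Data.List.Properties using (++-assoc; ++-identityʳ; ++-ʳ++; length-++; length-map; length-reverse; length-ʳ++; map-++; map-injective; map-ʳ++; reverse-involutive; unfold-reverse; ʳ++-ʳ++; ∷-injectiveˡ; ∷-injectiveʳ)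
open import Data.List.Relation.Binary.Permutation.Propositional using (_↭_; ↭-refl; ↭-trans; ↭-sym; prep; ↭⇒↭ₛ)
open import Data.List.Relation.Binary.Permutation.Propositional.Properties using (shift; ↭-length)
open import Data.List.Relation.Binary.Permutation.Setoid.Properties using (AllPairs-resp-↭)
open import Data.List.Relation.Binary.Sublist.Propositional using (_⊆_; []; _∷_; _∷ʳ_; ⊆-trans)
open import Data.List.Relation.Ternary.Interleaving.Propositional using (Interleaving; []; consˡ; consʳ)
open import Data.List.Relation.Ternary.Interleaving.Properties using (interleave-length)
open import Data.List.Relation.Unary.All as All using (All; []; _∷_)
open import Data.List.Relation.Unary.All.Properties using (++⁻ʳ)
open import Data.List.Relation.Unary.AllPairs using (AllPairs; []; _∷_)
open import Data.List.Relation.Unary.Any as Any using (here; there; index)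
open import Data.List.Relation.Unary.Any.Properties using (lookup-index)
open import Data.Maybe using (Maybe; just; nothing; maybe′)
open import Data.Nat using (ℕ; zero; suc; _+_; _*_; _∸_; _≤_; _<_; _≤ᵇ_; z≤n; s≤s)
open import Data.Nat.Properties hiding (suc-injective)
open import Data.Nat.Solver using (module +-*-Solver)
open import Data.Product using (Σ; ∃-syntax; _×_; _,_; proj₁; proj₂; map₁)
open import Data.Sum using (_⊎_; inj₁; inj₂; [_,_]′)
open import Data.Unit using (⊤; tt)
open import Data.Vec as Vec using (Vec; []; _∷_; here; there)
import Data.Vec.Properties as Vecₚ
open import Function using (_∘_; id; const; mk⇔; Equivalence)
open import Relation.Binary.PropositionalEquality hiding ([_])
open import Relation.Nullary using (¬_; contradiction)
open import Relation.Unary using (_≬_)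

open import Defs

-- Programs

-- Codes of objects are arbitrary bit strings: nothing provides a machine that decides whether a
-- block is a code, or whether two objects meet. Both machines therefore treat blocks as opaque
-- text. The new verifier never inspects a colouring. What remains for the parser is that the
-- summands add up to `k` and that `k` itself is canonical.
--
-- The reduction is applied to arbitrary words, also to those that encode nothing, so it must be a
-- textual operation from whose result the shape of the argument can be recovered. It repeats what
-- follows the first separator and puts a zero bit in front of a nonempty binary number.
--
-- Machines are concrete objects that must halt on every input within an explicit polynomial. Hence
-- programs are specified together with step bounds, composed at that level, and translated into
-- machines only at the end.

record Finite (Q : Set) : Set where
  no-eta-equality
  field
    elements : List Q
    complete : ∀ q → q ∈ elements

  encodeFin : Q → Fin (length elements)
  encodeFin q = index (complete q)

  decodeFin : Fin (length elements) → Q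
  decodeFin = lookup elements

  -- Repetitions in `elements` are harmless: a simulation only passes through numbers that encode
  -- states, so one direction of the inverse suffices.
  decode-encode : ∀ q → decodeFin (encodeFin q) ≡ q
  decode-encode q = sym (lookup-index (complete q))

open Finite

unit-finite : Finite ⊤
unit-finite .elements = [ tt ]
unit-finite .complete tt = here refl

bool-finite : Finite Bool
bool-finite .elements = false ∷ true ∷ []
bool-finite .complete false = here refl
bool-finite .complete true = there (here refl)

fin-finite : ∀ n → Finite (Fin n)
fin-finite n .elements = List.allFin n
fin-finite n .complete = ∈-allFin

Σ-finite : {A : Set} {B : A → Set} → Finite A → (∀ a → Finite (B a)) → Finite (Σ A B)
Σ-finite fA fB .elements = concatMap (λ a → map (a ,_) (fB a .elements)) (fA .elements)
Σ-finite fA fB .complete (a , b) = ∈-concatMap⁺ _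
  (Any.map (λ { refl → ∈-map⁺ (a ,_) (fB a .complete b) }) (fA .complete a))

⊎-finite : {A B : Set} → Finite A → Finite B → Finite (A ⊎ B)
⊎-finite fA fB .elements = map inj₁ (fA .elements) ++ map inj₂ (fB .elements)
⊎-finite fA fB .complete (inj₁ a) = ∈-++⁺ˡ (∈-map⁺ inj₁ (fA .complete a))
⊎-finite fA fB .complete (inj₂ b) = ∈-++⁺ʳ _ (∈-map⁺ inj₂ (fB .complete b))

-- Tape layouts and lenses between them

data Shape : Set where
  single : Shape
  many   : ℕ → Shape
  _⊗_    : Shape → Shape → Shape

infixr 4 _⊗_

Arr : Shape → Set → Set
Arr single   X = X
Arr (many n) X = Vec X n
Arr (S ⊗ T)  X = Arr S X × Arr T X

mapA : ∀ S {X Y : Set} → (X → Y) → Arr S X → Arr S Y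
mapA single   f x       = f x
mapA (many n) f v       = Vec.map f v
mapA (S ⊗ T)  f (a , b) = mapA S f a , mapA T f b

zipA : ∀ S {X Y Z : Set} → (X → Y → Z) → Arr S X → Arr S Y → Arr S Z
zipA single   f x       y       = f x y
zipA (many n) f v       u       = Vec.zipWith f v u
zipA (S ⊗ T)  f (a , b) (c , d) = zipA S f a c , zipA T f b d

pureA : ∀ S {X : Set} → X → Arr S X
pureA single   x = x
pureA (many n) x = Vec.replicate n x
pureA (S ⊗ T)  x = pureA S x , pureA T x

size : Shape → ℕ
size single   = 1
size (many n) = n
size (S ⊗ T)  = size S + size T

flat : ∀ S {X : Set} → Arr S X → Vec X (size S)
flat single   x       = x ∷ []
flat (many n) v       = v
flat (S ⊗ T)  (a , b) = flat S a Vec.++ flat T b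

unflat : ∀ S {X : Set} → Vec X (size S) → Arr S X
unflat single   v = Vec.head v
unflat (many n) v = v
unflat (S ⊗ T)  v = unflat S (Vec.take (size S) v) , unflat T (Vec.drop (size S) v)

take-++ : ∀ {X : Set} {m n} (u : Vec X m) (v : Vec X n) → Vec.take m (u Vec.++ v) ≡ u
take-++ {m = m} u v =
    proj₁ (Vecₚ.++-injective (Vec.take m (u Vec.++ v)) u (Vecₚ.take++drop≡id m (u Vec.++ v)))

drop-++ : ∀ {X : Set} {m n} (u : Vec X m) (v : Vec X n) → Vec.drop m (u Vec.++ v) ≡ v
drop-++ {m = m} u v =
    proj₂ (Vecₚ.++-injective (Vec.take m (u Vec.++ v)) u (Vecₚ.take++drop≡id m (u Vec.++ v)))

unflat-flat : ∀ S {X : Set} (a : Arr S X) → unflat S (flat S a) ≡ a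
unflat-flat single   x       = refl
unflat-flat (many n) v       = refl
unflat-flat (S ⊗ T)  (a , b)
  rewrite take-++ (flat S a) (flat T b) | drop-++ (flat S a) (flat T b) =
  cong₂ _,_ (unflat-flat S a) (unflat-flat T b)

flat-map : ∀ S {X Y : Set} (f : X → Y) (a : Arr S X) → Vec.map f (flat S a) ≡ flat S (mapA S f a)
flat-map single   f x       = refl
flat-map (many n) f v       = refl
flat-map (S ⊗ T)  f (a , b) =
  trans (Vecₚ.map-++ f (flat S a) (flat T b)) (cong₂ Vec._++_ (flat-map S f a) (flat-map T f b))

flat-zip : ∀ S {X Y Z : Set} (f : X → Y → Z) (a : Arr S X) (b : Arr S Y) →
  Vec.zipWith f (flat S a) (flat S b) ≡ flat S (zipA S f a b)
flat-zip single   f x       y       = refl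
flat-zip (many n) f v       u       = refl
flat-zip (S ⊗ T)  f (a , b) (c , d) =
  trans (Vecₚ.zipWith-++ f (flat S a) (flat T b) (flat S c) (flat T d))
        (cong₂ Vec._++_ (flat-zip S f a c) (flat-zip T f b d))

flat-pure : ∀ S {X : Set} (x : X) → flat S (pureA S x) ≡ Vec.replicate (size S) x
flat-pure single   x = refl
flat-pure (many n) x = refl
flat-pure (S ⊗ T)  x =
  trans (cong₂ Vec._++_ (flat-pure S x) (flat-pure T x)) (replicate-++ (size S))
  where
  replicate-++ : ∀ m → Vec.replicate m x Vec.++ Vec.replicate (size T) x ≡ Vec.replicate
      (m + size T) x
  replicate-++ zero    = refl
  replicate-++ (suc m) = cong (x ∷_) (replicate-++ m)

-- The same lens has to serve for cells, actions and tapes, hence the polymorphism in `X`. `get-map`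
-- lets it commute with reading the heads and `put-zip` with acting on the tapes; the other laws are
-- the usual ones.
record Lens (S T : Shape) : Set₁ where
  field
    get     : {X : Set} → Arr S X → Arr T X
    put     : {X : Set} → Arr T X → Arr S X → Arr S X
    get-put : {X : Set} (t : Arr T X) (s : Arr S X) → get (put t s) ≡ t
    put-put : {X : Set} (t u : Arr T X) (s : Arr S X) → put t (put u s) ≡ put t s
    put-get : {X : Set} (s : Arr S X) → put (get s) s ≡ s
    get-map : {X Y : Set} (f : X → Y) (s : Arr S X) → get (mapA S f s) ≡ mapA T f (get s)
    put-zip : {X Y Z : Set} (f : X → Y → Z) (t : Arr T X) (r : Arr S X) (s : Arr S Y) →
              zipA S f (put t r) s ≡ put (zipA T f t (get s)) (zipA S f r s)

open Lens

idL : ∀ {S} → Lens S S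
idL .get s           = s
idL .put t s         = t
idL .get-put t s     = refl
idL .put-put t u s   = refl
idL .put-get s       = refl
idL .get-map f s     = refl
idL .put-zip f t r s = refl

fstL : ∀ {S T} → Lens (S ⊗ T) S
fstL .get (a , b)               = a
fstL .put c (a , b)             = c , b
fstL .get-put c (a , b)         = refl
fstL .put-put c d (a , b)       = refl
fstL .put-get (a , b)           = refl
fstL .get-map f (a , b)         = refl
fstL .put-zip f c (a , b) (_ , _) = refl

sndL : ∀ {S T} → Lens (S ⊗ T) T
sndL .get (a , b)               = b
sndL .put c (a , b)             = a , c
sndL .get-put c (a , b)         = refl
sndL .put-put c d (a , b)       = refl
sndL .put-get (a , b)           = refl
sndL .get-map f (a , b)         = refl
sndL .put-zip f c (a , b) (_ , _) = refl

infixr 9 _⨾_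

_⨾_ : ∀ {S T U} → Lens S T → Lens T U → Lens S U
(L ⨾ M) .get s           = get M (get L s)
(L ⨾ M) .put u s         = put L (put M u (get L s)) s
(L ⨾ M) .get-put u s     = trans (cong (get M) (get-put L _ s)) (get-put M u _)
(L ⨾ M) .put-put u v s   =
  trans (put-put L _ _ s)
        (cong (λ t → put L t s) (trans (cong (put M u) (get-put L _ s)) (put-put M u v _)))
(L ⨾ M) .put-get s       = trans (cong (λ t → put L t s) (put-get M _)) (put-get L s)
(L ⨾ M) .get-map f s     = trans (cong (get M) (get-map L f s)) (get-map M f _)
_⨾_ {S} {T} L M .put-zip f u r s =
  trans (put-zip L f _ r s)
        (cong (λ t → put L t (zipA S f r s))
              (trans (put-zip M f u _ _) (cong (put M _) (lemma f r s))))
  where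
  lemma : ∀ {X Y Z : Set} (f : X → Y → Z) r s →
    zipA T f (get L r) (get L s) ≡ get L (zipA S f r s)
  -- That `get` commutes with `zipA` is no field of the record: it is `put-zip` at `get L r`, where
  -- `put-get` removes the inner `put` and `get-put` the outer one.
  lemma f r s = sym (trans (cong (get L) (sym (trans
    (sym (put-zip L f (get L r) r s)) (cong (λ q → zipA S f q s) (put-get L r)))))
    (get-put L _ _))

-- Automata with exit values and their step-bounded specifications

module Programs (w : ℕ) where

  Cells Actions Tapes : Shape → Set
  Cells S   = Arr S (Cell w)
  Actions S = Arr S (Cell w × Move)
  Tapes S   = Arr S (Tape w)

  heads : ∀ S → Tapes S → Cells S
  heads S = mapA S Tape.head

  perform : ∀ S → Actions S → Tapes S → Tapes S
  perform S = zipA S act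

  idle : ∀ S → Cells S → Actions S
  idle S = mapA S (_, stay)

  perform-idle : ∀ S ts → perform S (idle S (heads S ts)) ts ≡ ts
  perform-idle single   t          = refl
  perform-idle (many _) []         = refl
  perform-idle (many _) (t ∷ ts)   = cong (t ∷_) (perform-idle (many _) ts)
  perform-idle (S ⊗ T)  (ts , us)  = cong₂ _,_ (perform-idle S ts) (perform-idle T us)

  -- Leaving is a transition like any other, with a value and final actions. In a composition it is
  -- redirected straight to the next start state, so that sequencing costs no step of its own and
  -- bounds simply add up.
  record Automaton (S : Shape) (A : Set) : Set₁ where
    no-eta-equality
    field
      State  : Set
      finite : Finite State
      δ      : State → Cells S → (State ⊎ A) × Actions S

  open Automaton

  Post : Shape → Set → Set₁
  Post S A = A → Tapes S → Set

  mutual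

    -- Started in state q on the tapes ts, the automaton exits within n steps,
    -- and its exit value and final tapes satisfy Φ.
    data Runs {S A} (M : Automaton S A) (Φ : Post S A) : ℕ → State M → Tapes S → Set where
      step : ∀ {n q ts} →
        Continues M Φ n (proj₁ (δ M q (heads S ts))) (perform S (proj₂ (δ M q (heads S ts))) ts) →
        Runs M Φ (suc n) q ts

    data Continues {S A} (M : Automaton S A) (Φ : Post S A) (n : ℕ) :
        State M ⊎ A → Tapes S → Set where
      running : ∀ {q ts} → Runs M Φ n q ts → Continues M Φ n (inj₁ q) ts
      exited  : ∀ {a ts} → Φ a ts → Continues M Φ n (inj₂ a) ts

  mutual

    Runs-mono : ∀ {S A} {M : Automaton S A} {Φ Ψ} → (∀ a ts → Φ a ts → Ψ a ts) →
      ∀ {m n} → m ≤ n → ∀ {q ts} → Runs M Φ m q ts → Runs M Ψ n q ts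
    Runs-mono imp (s≤s m≤n) (step r) = step (Continues-mono imp m≤n r)

    Continues-mono : ∀ {S A} {M : Automaton S A} {Φ Ψ} → (∀ a ts → Φ a ts → Ψ a ts) →
      ∀ {m n} → m ≤ n → ∀ {r ts} → Continues M Φ m r ts → Continues M Ψ n r ts
    Continues-mono imp m≤n (running r) = running (Runs-mono imp m≤n r)
    Continues-mono imp m≤n (exited φ)  = exited (imp _ _ φ)

  record Program (S : Shape) (A : Set) : Set₁ where
    no-eta-equality
    field
      automaton : Automaton S A
      start     : State automaton

  open Program

  -- A total-correctness triple with a step bound. The record keeps `P` recoverable by unification,
  -- which a bare `Runs` over `automaton P` and `start P` would not.
  record ⟨_⟩ {S A} (P : Program S A) (n : ℕ) (ts : Tapes S) (Φ : Post S A) : Set where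
    constructor started
    field history : Runs (automaton P) Φ n (start P) ts

  open ⟨_⟩

  ⟨⟩-mono : ∀ {S A} {P : Program S A} {Φ Ψ m n ts} → (∀ a ts′ → Φ a ts′ → Ψ a ts′) → m ≤ n →
    ⟨ P ⟩ m ts Φ → ⟨ P ⟩ n ts Ψ
  ⟨⟩-mono imp m≤n (started r) = started (Runs-mono imp m≤n r)

  prim : ∀ {S A} → (Cells S → A × Actions S) → Program S A
  prim f .automaton .State      = ⊤
  prim f .automaton .finite     = unit-finite
  prim f .automaton .δ _ cs     = inj₂ (proj₁ (f cs)) , proj₂ (f cs)
  prim f .start                 = tt

  prim-spec : ∀ {S A} {f : Cells S → A × Actions S} {n ts} {Φ : Post S A} →
    Φ (proj₁ (f (heads S ts))) (perform S (proj₂ (f (heads S ts))) ts) → ⟨ prim f ⟩ (suc n) ts Φ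
  prim-spec φ = started (step (exited φ))

  return : ∀ {S A} → A → Program S A
  return {S} a = prim λ cs → a , idle S cs

  return-spec : ∀ {S A} {a : A} {n ts} {Φ : Post S A} → Φ a ts → ⟨ return a ⟩ (suc n) ts Φ
  return-spec {S} {a = a} {Φ = Φ} φ = prim-spec (subst (Φ a) (sym (perform-idle S _)) φ)

  -- The continuation depends on the exit value, which is therefore remembered in the control state;
  -- this is where finiteness of `A` comes from.
  module Bind {S A B} (finA : Finite A) (P : Program S A) (k : A → Program S B) where

    redirect : State (automaton P) ⊎ A →
      (State (automaton P) ⊎ Σ A (λ a → State (automaton (k a)))) ⊎ B
    redirect (inj₁ q) = inj₁ (inj₁ q)
    redirect (inj₂ a) = inj₁ (inj₂ (a , start (k a)))

    second : ∀ a → State (automaton (k a)) ⊎ B →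
      (State (automaton P) ⊎ Σ A (λ a → State (automaton (k a)))) ⊎ B
    second a (inj₁ q) = inj₁ (inj₂ (a , q))
    second a (inj₂ b) = inj₂ b

    program : Program S B
    program .automaton .State  = State (automaton P) ⊎ Σ A (λ a → State (automaton (k a)))
    program .automaton .finite =
      ⊎-finite (finite (automaton P)) (Σ-finite finA (λ a → finite (automaton (k a))))
    program .automaton .δ (inj₁ q)       cs = map₁ redirect (δ (automaton P) q cs)
    program .automaton .δ (inj₂ (a , q)) cs = map₁ (second a) (δ (automaton (k a)) q cs)
    program .start = inj₁ (start P)

    module _ {Φ : Post S B} where

      mutual

        second-runs : ∀ {a n q ts} → Runs (automaton (k a)) Φ n q ts →
          Runs (automaton program) Φ n (inj₂ (a , q)) ts
        second-runs (step r) = step (second-continues r)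

        second-continues : ∀ {a n r ts} → Continues (automaton (k a)) Φ n r ts →
          Continues (automaton program) Φ n (second a r) ts
        second-continues (running r) = running (second-runs r)
        second-continues (exited φ)  = exited φ

      mutual

        runs : ∀ {m n q ts} → Runs (automaton P) (λ a ts′ → ⟨ k a ⟩ n ts′ Φ) m q ts →
          Runs (automaton program) Φ (m + n) (inj₁ q) ts
        runs (step r) = step (continues r)

        continues : ∀ {m n r ts} → Continues (automaton P) (λ a ts′ → ⟨ k a ⟩ n ts′ Φ) m r ts →
          Continues (automaton program) Φ (m + n) (redirect r) ts
        continues         (running r) = running (runs r)
        continues {m} {n} (exited φ)  =
          running (Runs-mono (λ _ _ → id) (m≤n+m n m) (second-runs (history φ)))

  bind : ∀ {S A B} → Finite A → Program S A → (A → Program S B) → Program S B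
  bind = Bind.program

  bind-spec : ∀ {S A B} {finA : Finite A} {P : Program S A} {k : A → Program S B} {m n ts Φ} →
    ⟨ P ⟩ m ts (λ a ts′ → ⟨ k a ⟩ n ts′ Φ) → ⟨ bind finA P k ⟩ (m + n) ts Φ
  bind-spec {finA = finA} {P} {k} (started r) = started (Bind.runs finA P k r)

  infixl 1 _>>_

  _>>_ : ∀ {S A} → Program S ⊤ → Program S A → Program S A
  P >> R = bind unit-finite P (λ _ → R)

  >>-spec : ∀ {S A} {P : Program S ⊤} {R : Program S A} {m n ts Φ} →
    ⟨ P ⟩ m ts (λ _ ts′ → ⟨ R ⟩ n ts′ Φ) → ⟨ P >> R ⟩ (m + n) ts Φ
  >>-spec = bind-spec

  module Loop {S B I} (finI : Finite I) (body : I → Program S (I ⊎ B)) where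

    redirect : ∀ i → State (automaton (body i)) ⊎ (I ⊎ B) →
      Σ I (λ i → State (automaton (body i))) ⊎ B
    redirect i (inj₁ q)        = inj₁ (i , q)
    redirect i (inj₂ (inj₁ j)) = inj₁ (j , start (body j))
    redirect i (inj₂ (inj₂ b)) = inj₂ b

    control : Automaton S B
    control .State        = Σ I (λ i → State (automaton (body i)))
    control .finite       = Σ-finite finI (λ i → finite (automaton (body i)))
    control .δ (i , q) cs = map₁ (redirect i) (δ (automaton (body i)) q cs)

    program : I → Program S B
    program i .automaton = control
    program i .start     = i , start (body i)

    -- A round either ends the loop or re-enters it with `n` steps left. No variant is built in:
    -- `loop-spec` unfolds a single round, and each use supplies its own induction.
    Next : Post S B → ℕ → Post S (I ⊎ B)
    Next Φ n (inj₁ j) ts = ⟨ program j ⟩ n ts Φ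
    Next Φ n (inj₂ b) ts = Φ b ts

    module _ {Φ : Post S B} where

      mutual

        runs : ∀ {m n i q ts} → Runs (automaton (body i)) (Next Φ n) m q ts →
          Runs control Φ (m + n) (i , q) ts
        runs (step r) = step (continues r)

        continues : ∀ {m n i r ts} → Continues (automaton (body i)) (Next Φ n) m r ts →
          Continues control Φ (m + n) (redirect i r) ts
        continues         (running r)             = running (runs r)
        continues {m} {n} (exited {a = inj₁ j} r) =
            running (Runs-mono (λ _ _ → id) (m≤n+m n m) (history r))
        continues         (exited {a = inj₂ b} φ) = exited φ

  loop : ∀ {S B I} → Finite I → (I → Program S (I ⊎ B)) → I → Program S B
  loop = Loop.program

  loop-spec : ∀ {S B I} {finI : Finite I} {body : I → Program S (I ⊎ B)} {i m n ts Φ} →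
    ⟨ body i ⟩ m ts (Loop.Next finI body Φ n) → ⟨ loop finI body i ⟩ (m + n) ts Φ
  loop-spec {finI = finI} {body} {i} (started r) = started (Loop.runs finI body r)

  module On {S T A} (L : Lens S T) (P : Program T A) where

    program : Program S A
    program .automaton .State  = State (automaton P)
    program .automaton .finite = finite (automaton P)
    program .automaton .δ q cs =
      proj₁ (δ (automaton P) q (get L cs)) ,
      put L (proj₂ (δ (automaton P) q (get L cs))) (idle S cs)
    program .start = start P

    module _ {Φ : Post S A} (s : Tapes S) where

      mutual

        runs : ∀ {n q t} → Runs (automaton P) (λ a t′ → Φ a (put L t′ s)) n q t →
          Runs (automaton program) Φ n q (put L t s)
        -- The tapes outside the focus get their own symbols back. `put-zip` moves the step of `P`
        -- under `put`, `perform-idle` makes the rest disappear, and `put-put` brings back `s` as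
        -- the fixed background.
        runs {q = q} {t} (step r) = step (subst₂ (Continues (automaton program) Φ _)
          (cong (λ cs → proj₁ (δ (automaton P) q cs)) (sym heads≡))
          (sym (trans (put-zip L act _ _ _)
            (trans (cong₂ (put L)
                (cong₂ (perform T) (cong (λ cs → proj₂ (δ (automaton P) q cs)) heads≡)
                                                     (get-put L t s))
                                  (perform-idle S _))
                   (put-put L _ t s))))
          (continues r))
          where
          heads≡ : get L (heads S (put L t s)) ≡ heads T t
          heads≡ = trans (get-map L Tape.head _) (cong (heads T) (get-put L t s))

        continues : ∀ {n r t} → Continues (automaton P) (λ a t′ → Φ a (put L t′ s)) n r t →
          Continues (automaton program) Φ n r (put L t s)
        continues (running r) = running (runs r)
        continues (exited φ)  = exited φ

  on : ∀ {S T A} → Lens S T → Program T A → Program S A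
  on = On.program

  on-spec : ∀ {S T A} {L : Lens S T} {P : Program T A} {n s Φ} →
    ⟨ P ⟩ n (get L s) (λ a t → Φ a (put L t s)) → ⟨ on L P ⟩ n s Φ
  on-spec {L = L} {P} {n} {s} {Φ} (started r) =
    subst (λ s′ → ⟨ on L P ⟩ n s′ Φ) (put-get L s) (started (On.runs L P s r))

-- Programs and Turing machines

open Finite

Standard : Shape → Shape
Standard S = (single ⊗ single) ⊗ S

module _ (M : TuringMachine) where
  open TuringMachine M renaming (step to stepM)

  run-halted : ∀ {c} n → Halted c → run n c ≡ c
  run-halted         zero    h = refl
  run-halted {c = c} (suc n) h rewrite h = refl

  run-step : ∀ {c c′} n → stepM c ≡ just c′ → run (suc n) c ≡ run n c′
  run-step n eq rewrite eq = refl

module Embed (M : TuringMachine) where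
  open TuringMachine M renaming (step to stepM; start to startM; δ to δM)
  open Programs workSymbols

  split : ∀ {X : Set} → Vec X tapes → Arr (Standard (many extraTapes)) X
  split (x ∷ y ∷ v) = (x , y) , v

  join : ∀ {X : Set} → Arr (Standard (many extraTapes)) X → Vec X tapes
  join ((x , y) , v) = x ∷ y ∷ v

  -- Halting, which is an undefined transition, becomes an exit that returns the verdict and leaves
  -- the tapes alone. It accounts for the one extra step in `embed-spec`.
  respond : State → Cells (Standard (many extraTapes)) →
    Maybe (State × Vec (Cell workSymbols × Move) tapes) →
    (State ⊎ Bool) × Actions (Standard (many extraTapes))
  respond q cs nothing         = inj₂ (accepting q) , idle _ cs
  respond q cs (just (q′ , v)) = inj₁ q′ , split v

  automaton : Automaton (Standard (many extraTapes)) Bool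
  automaton = record
    { State  = State
    ; finite = fin-finite states
    ; δ      = λ q cs → respond q cs (δM q (join cs))
    }

  embed : Program (Standard (many extraTapes)) Bool
  embed = record { automaton = automaton ; start = startM }

  runs : ∀ n {q ts} {Φ : Post (Standard (many extraTapes)) Bool} →
    Halted (run n (q , join ts)) →
    Φ (accepting (proj₁ (run n (q , join ts)))) (split (proj₂ (run n (q , join ts)))) →
    Runs automaton Φ (suc n) q ts
  runs n {q} {ts} {Φ} h φ = step (go n (δM q (join (heads _ ts))) refl h φ)
    where
    go : ∀ n r → δM q (join (heads _ ts)) ≡ r →
      Halted (run n (q , join ts)) →
      Φ (accepting (proj₁ (run n (q , join ts)))) (split (proj₂ (run n (q , join ts)))) →
      Continues automaton Φ n (proj₁ (respond q (heads _ ts) r))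
        (perform _ (proj₂ (respond q (heads _ ts) r)) ts)
    go n nothing eq h φ
      rewrite run-halted M {q , join ts} n (cong (maybe′ _ nothing) eq) | perform-idle _ ts =
          exited φ
    go (suc n) (just (q′ , a ∷ b ∷ v)) eq h φ
      rewrite run-step M {q , join ts} n (cong (maybe′ _ nothing) eq) = running (runs n h φ)
    go zero (just (q′ , v)) eq h φ with () ← trans (sym h) (cong (maybe′ _ nothing) eq)

  embed-spec : ∀ n {ts} {Φ : Post (Standard (many extraTapes)) Bool} →
    Halted (run n (startM , join ts)) →
    Φ (accepting (proj₁ (run n (startM , join ts)))) (split (proj₂ (run n (startM , join ts)))) →
    ⟨ embed ⟩ (suc n) ts Φ
  embed-spec n h φ = started (runs n h φ)

module _ {w S} (P : Programs.Program w (Standard S) Bool) where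

  open Programs w

  open Automaton (Program.automaton P) renaming
      (State to Control; finite to control-finite; δ to δP)

  private
    fin : Finite (Control ⊎ Bool)
    fin = ⊎-finite control-finite bool-finite

    transition : (Control ⊎ Bool) × Actions (Standard S) →
      Maybe (Fin (length (elements fin)) × Vec (Cell w × Move) (2 + size S))
    transition (r , as) = just (encodeFin fin r , flat (Standard S) as)

  -- The exit values become additional control states without transitions, so that entering one of
  -- them halts the machine; only `inj₂ true` accepts.
  compile : TuringMachine
  compile = record
    { workSymbols = w
    ; extraTapes  = size S
    ; states      = length (elements fin)
    ; start       = encodeFin fin (inj₁ (Program.start P))
    ; accepting   = [ const false , id ]′ ∘ decodeFin fin
    ; δ           = λ q cs → [ (λ q′ → transition (δP q′ (unflat (Standard S) cs))) ,
        const nothing ]′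
                             (decodeFin fin q)
    }

  open TuringMachine compile using (Configuration; run; Halted; accepting; initial) renaming
      (step to stepM)

  private
    config : Control ⊎ Bool → Tapes (Standard S) → Configuration
    config r ts = encodeFin fin r , flat (Standard S) ts

    step-running : ∀ q ts → stepM (config (inj₁ q) ts) ≡
      just (config (proj₁ (δP q (heads (Standard S) ts)))
                   (perform (Standard S) (proj₂ (δP q (heads (Standard S) ts))) ts))
    step-running q ts
      rewrite decode-encode fin (inj₁ q)
            | flat-map S Tape.head (proj₂ ts)
            | unflat-flat S (heads S (proj₂ ts))
            | flat-zip S act (proj₂ (proj₂ (δP q (heads (Standard S) ts)))) (proj₂ ts) = refl

    step-exited : ∀ b ts → Halted (config (inj₂ b) ts)
    step-exited b ts rewrite decode-encode fin (inj₂ b) = refl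

    mutual

      runs : ∀ {Φ n q ts} → Runs (Program.automaton P) Φ n q ts →
        ∃[ b ] ∃[ ts′ ] Φ b ts′ × run n (config (inj₁ q) ts) ≡ config (inj₂ b) ts′
      runs {n = suc n} {q} {ts} (step r) with b , ts′ , φ , eq ← continues r =
        b , ts′ , φ , trans (run-step compile n (step-running q ts)) eq

      continues : ∀ {Φ n r ts} → Continues (Program.automaton P) Φ n r ts →
        ∃[ b ] ∃[ ts′ ] Φ b ts′ × run n (config r ts) ≡ config (inj₂ b) ts′
      continues         (running r)                  = runs r
      continues {n = n} (exited {a = b} {ts = ts} φ) =
          b , ts , φ , run-halted compile n (step-exited b ts)

  compile-spec : ∀ {Φ n} u v → ⟨ P ⟩ n ((loadTape u , loadTape v) , pureA S emptyTape) Φ →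
    Halted (run n (initial u v)) ×
    ∃[ ts ] Φ (accepting (proj₁ (run n (initial u v)))) ts ×
            proj₂ (run n (initial u v)) ≡ flat (Standard S) ts
  compile-spec {Φ} {n} u v (started r) with b , ts , φ , eq ← runs r
    rewrite sym (flat-pure S (emptyTape {w})) | eq | decode-encode fin (inj₂ b) =
    refl , ts , φ , refl

-- Repeating a program polynomially often

module Clocks (w : ℕ) where
  open Programs w

  at : List (Cell w) → List (Cell w) → Tape w
  at ls []       = tape ls blank []
  at ls (a ∷ rs) = tape ls a rs

  moveHead-right : ∀ ls a rs → moveHead right (tape ls a rs) ≡ at (a ∷ ls) rs
  moveHead-right ls a []       = refl
  moveHead-right ls a (_ ∷ _) = refl

  isInput : Cell w → Bool
  isInput (input _) = true
  isInput _         = false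

  moveLeft moveRight : Program single ⊤
  moveLeft  = prim λ c → tt , (c , left)
  moveRight = prim λ c → tt , (c , right)

  testInput : Program single Bool
  testInput = prim λ c → isInput c , (c , stay)

  skipInput : Cell w → (⊤ ⊎ ⊤) × (Cell w × Move)
  skipInput (input a) = inj₁ tt , (input a , right)
  skipInput c         = inj₂ tt , (c , stay)

  skipInputs : Program single ⊤
  skipInputs = loop unit-finite (λ _ → prim skipInput) tt

  -- The bound has the form "rounds times cost of the body" so that one unfolding of the loop
  -- matches it by computation; `n` is slack left to the caller.
  skipInputs-spec : ∀ us {ls rs n Φ} →
    Φ tt (tape (map input us ʳ++ ls) blank rs) →
    ⟨ skipInputs ⟩ (suc (length us) * 1 + n) (at ls (map input us ++ blank ∷ rs)) Φ
  skipInputs-spec []       φ = loop-spec {m = 1} (prim-spec φ)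
  skipInputs-spec (a ∷ us) {ls} {rs} φ = loop-spec {m = 1} (prim-spec
    (subst (λ t → ⟨ skipInputs ⟩ _ t _)
        (sym (moveHead-right ls (input a) (map input us ++ blank ∷ rs)))
           (skipInputs-spec us φ)))

  rewind : Program single ⊤
  rewind = moveRight >> skipInputs

  rewind-spec : ∀ us {ls rs n Φ} →
    Φ tt (tape (map input us ʳ++ (blank ∷ ls)) blank rs) →
    ⟨ rewind ⟩ (1 + (suc (length us) * 1 + n)) (tape ls blank (map input us ++ blank ∷ rs)) Φ
  rewind-spec us {ls} {rs} φ = >>-spec {m = 1} (prim-spec
    (subst (λ t → ⟨ skipInputs ⟩ _ t _) (sym (moveHead-right ls blank (map input us ++ blank ∷ rs)))
           (skipInputs-spec us φ)))

  -- A clock tape holds a word to the left of the head; extra blanks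
  -- accumulate below it whenever the head has run off its left end.
  Clock : Word → Tape w → Set
  Clock u t = ∃[ j ] ∃[ rs ] t ≡ tape (map input u ++ replicate j blank) blank rs

  -- `B` runs once for each symbol that the clock head passes on its way to the left. The symbols
  -- stay in place and the head is brought back, so an enclosing loop can use the same clock again.
  module Sweep {T : Shape} (B : Program T ⊤) where

    again : Bool → Program (single ⊗ T) (⊤ ⊎ ⊤)
    again true  = on sndL B >> return (inj₁ tt)
    again false = return (inj₂ tt)

    body : ⊤ → Program (single ⊗ T) (⊤ ⊎ ⊤)
    body _ = on fstL moveLeft >> bind bool-finite (on fstL testInput) again

    sweep : Program (single ⊗ T) ⊤
    sweep = loop unit-finite body tt

    perSymbol : Program (single ⊗ T) ⊤
    perSymbol = sweep >> on fstL rewind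

    module _ (J : ℕ → Tapes T → Set) {b : ℕ}
             (B-spec : ∀ i t → J i t → ⟨ B ⟩ b t (λ _ → J (suc i))) where

      -- `us` is what the head has still to pass and `ps` what it has passed. Head cell and right
      -- part are abstracted to `h` and `R` because the head is on a blank at the start and on a
      -- symbol of the clock in later rounds.
      sweep-spec : ∀ us ps j rs i ts {h R} → h ∷ R ≡ map input ps ++ blank ∷ rs → J i ts →
        ⟨ sweep ⟩ (suc (length us) * (1 + (1 + (b + 1))))
            (tape (map input us ++ replicate j blank) h R , ts)
          (λ { _ (t , ts′) → J (length us + i) ts′ ×
               ∃[ j′ ] t ≡ tape (replicate j′ blank) blank (map input (us ʳ++ ps) ++ blank ∷ rs) })
      sweep-spec [] ps zero rs i ts eq ji =
        loop-spec (>>-spec {m = 1} (on-spec (prim-spec (bind-spec {m = 1} (on-spec (prim-spec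
          (⟨⟩-mono {m = 1} (λ _ _ → id) (m≤n+m 1 b)
              (return-spec (ji , 0 , cong (tape [] blank) eq)))))))))
      sweep-spec [] ps (suc j) rs i ts eq ji =
        loop-spec (>>-spec {m = 1} (on-spec (prim-spec (bind-spec {m = 1} (on-spec (prim-spec
          (⟨⟩-mono {m = 1} (λ _ _ → id) (m≤n+m 1 b)
              (return-spec (ji , j , cong (tape _ blank) eq)))))))))
      sweep-spec (a ∷ us) ps j rs i ts eq ji =
        loop-spec (>>-spec {m = 1} (on-spec (prim-spec (bind-spec {m = 1} (on-spec (prim-spec
          (>>-spec {m = b} (on-spec (⟨⟩-mono (λ _ ts′ ji′ → return-spec
            (⟨⟩-mono (λ { _ (_ , ts″) (ji″ , rest) →
                subst (λ k → J k ts″) (+-suc (length us) i) ji″ , rest }) ≤-refl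
              (sweep-spec us (a ∷ ps) j rs (suc i) ts′ (cong (input a ∷_) eq) ji′))) ≤-refl
                  (B-spec i ts ji))))))))))

      perSymbol-spec : ∀ us i t ts → Clock us t → J i ts →
        ⟨ perSymbol ⟩ (suc (length us) * (1 + (1 + (b + 1))) + (1 + suc (length us) * 1)) (t , ts)
          (λ { _ (t′ , ts′) → Clock us t′ × J (length us + i) ts′ })
      perSymbol-spec us i t ts (j , rs , refl) ji = >>-spec
        (⟨⟩-mono (λ { _ (_ , ts′) (ji′ , j′ , refl) → on-spec (⟨⟩-mono (λ _ _ → id)
            (≤-reflexive (cong (λ k → 1 + suc k)
                (trans (+-identityʳ _) (cong (_* 1) (length-reverse us)))))
            (rewind-spec (us ʳ++ []) {n = 0}
              ((suc j′ , rs , cong (λ ls → tape ls blank rs) (restored j′)) , ji′))) })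
          ≤-refl (sweep-spec us [] j rs i ts refl ji))
        where
        restored : ∀ j′ → map input (us ʳ++ []) ʳ++ (blank ∷ replicate j′ blank) ≡
                          map input us ++ replicate (suc j′) blank
        restored j′ = trans (cong (_ʳ++ _) (map-ʳ++ input us)) (ʳ++-ʳ++ (map input us))

  -- One clock tape for each occurrence of the variable.
  clocked : Polynomial → Shape → Shape
  clocked (con a)  T = T
  clocked var      T = single ⊗ T
  clocked (p :+ q) T = clocked p (clocked q T)
  clocked (p :* q) T = clocked p (clocked q T)

  innerL : ∀ p T → Lens (clocked p T) T
  innerL (con a)  T = idL
  innerL var      T = sndL
  innerL (p :+ q) T = innerL p (clocked q T) ⨾ innerL q T
  innerL (p :* q) T = innerL p (clocked q T) ⨾ innerL q T

  repeat : ∀ {T} → ℕ → Program T ⊤ → Program T ⊤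
  repeat zero    B = return tt
  repeat (suc a) B = repeat a B >> B

  times : ∀ p {T} → Program T ⊤ → Program (clocked p T) ⊤
  times (con a)  B = repeat a B
  times var      B = Sweep.perSymbol B
  times (p :+ q) {T} B = on (innerL p (clocked q T)) (times q B) >> times p (on (innerL q T) B)
  times (p :* q) B = times p (times q B)

  repeatTime : ℕ → Polynomial → Polynomial
  repeatTime zero    b = con 1
  repeatTime (suc a) b = repeatTime a b :+ b

  -- These polynomials copy the bounds of `repeat-spec` and `perSymbol-spec` summand by summand, so
  -- that their values agree with the step counts by computation.
  timesTime : Polynomial → Polynomial → Polynomial
  timesTime (con a)  b = repeatTime a b
  timesTime var      b =
      ((con 1 :+ var) :* (con 1 :+ (con 1 :+ (b :+ con 1)))) :+ (con 1 :+ ((con 1 :+ var) :* con 1))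
  timesTime (p :+ q) b = timesTime q b :+ timesTime p b
  timesTime (p :* q) b = timesTime p (timesTime q b)

  Clocked : ∀ p {T} → Word → (Tapes T → Set) → Tapes (clocked p T) → Set
  Clocked (con a)  u J ts       = J ts
  Clocked var      u J (t , ts) = Clock u t × J ts
  Clocked (p :+ q) {T} u J      = Clocked p {clocked q T} u (Clocked q u J)
  Clocked (p :* q) {T} u J      = Clocked p {clocked q T} u (Clocked q u J)

  Clocked-get : ∀ p {T u J} ts → Clocked p {T} u J ts → J (Lens.get (innerL p T) ts)
  Clocked-get (con a)  ts c = c
  Clocked-get var      ts c = proj₂ c
  Clocked-get (p :+ q) ts c = Clocked-get q _ (Clocked-get p ts c)
  Clocked-get (p :* q) ts c = Clocked-get q _ (Clocked-get p ts c)

  Clocked-put : ∀ p {T u} {J J′ : Tapes T → Set} {t} ts → Clocked p u J ts → J′ t →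
    Clocked p u J′ (Lens.put (innerL p T) t ts)
  Clocked-put (con a)  ts c j = j
  Clocked-put var      ts c j = proj₁ c , j
  Clocked-put (p :+ q) {T} {u} {J} {J′} ts c j =
    Clocked-put p {clocked q T} {u} {Clocked q u J} {Clocked q u J′} ts c
      (Clocked-put q {T} {u} {J} {J′} _ (Clocked-get p ts c) j)
  Clocked-put (p :* q) {T} {u} {J} {J′} ts c j =
    Clocked-put p {clocked q T} {u} {Clocked q u J} {Clocked q u J′} ts c
      (Clocked-put q {T} {u} {J} {J′} _ (Clocked-get p ts c) j)

  inner-spec : ∀ p {T u A} {P : Program T A} {n} {J : Tapes T → Set} {J′ : Post T A} ts →
    (∀ t → J t → ⟨ P ⟩ n t J′) → Clocked p u J ts →
    ⟨ on (innerL p T) P ⟩ n ts (λ a → Clocked p u (J′ a))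
  inner-spec p {u = u} {J = J} {J′} ts P-spec c = on-spec
    (⟨⟩-mono (λ a t j → Clocked-put p {u = u} {J} {J′ a} ts c j) ≤-refl
        (P-spec _ (Clocked-get p ts c)))

  module _ (u : Word) where

    repeat-spec : ∀ a {T} {B : Program T ⊤} b (J : ℕ → Tapes T → Set) →
      (∀ i t → J i t → ⟨ B ⟩ (⟦ b ⟧ (length u)) t (λ _ → J (suc i))) →
      ∀ i ts → J i ts → ⟨ repeat a B ⟩ (⟦ repeatTime a b ⟧ (length u)) ts (λ _ → J (a + i))
    repeat-spec zero    b J B-spec i ts c = return-spec c
    repeat-spec (suc a) b J B-spec i ts c =
      >>-spec (⟨⟩-mono (λ _ → B-spec _) ≤-refl (repeat-spec a b J B-spec i ts c))

    times-spec : ∀ p {T} {B : Program T ⊤} b (J : ℕ → Tapes T → Set) →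
      (∀ i t → J i t → ⟨ B ⟩ (⟦ b ⟧ (length u)) t (λ _ → J (suc i))) →
      ∀ i ts → Clocked p u (J i) ts →
      ⟨ times p B ⟩ (⟦ timesTime p b ⟧ (length u)) ts (λ _ → Clocked p u (J (⟦ p ⟧ (length u) + i)))
    times-spec (con a)  b J B-spec i ts c = repeat-spec a b J B-spec i ts c
    times-spec var {B = B} b J B-spec i (t , ts) (c , j) =
        Sweep.perSymbol-spec B J B-spec u i t ts c j
    times-spec (p :+ q) b J B-spec i ts c = >>-spec
      (⟨⟩-mono (λ _ ts′ c′ → ⟨⟩-mono (λ _ ts″ → subst (λ k → Clocked p u (Clocked q u (J k)) ts″)
            (sym (+-assoc (⟦ p ⟧ (length u)) _ i))) ≤-refl
          (times-spec p b (λ k → Clocked q u (J k)) (λ k t → inner-spec q t (B-spec k)) _ ts′ c′))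
              ≤-refl
        (inner-spec p ts (times-spec q b J B-spec i) c))
    times-spec (p :* q) b J B-spec i ts c =
      ⟨⟩-mono (λ _ ts″ → subst (λ k → Clocked p u (Clocked q u (J (k + i))) ts″)
          (cong (_* ⟦ q ⟧ (length u)) (+-identityʳ (⟦ p ⟧ (length u))))) ≤-refl
        -- A round of the outer loop advances the counter by the value of `q`; the invariant after
        -- `k` rounds is thus `J` at `k` times that value plus `i`.
        (times-spec p (timesTime q b) (λ k → Clocked q u (J (k * ⟦ q ⟧ (length u) + i)))
          (λ k t c′ → ⟨⟩-mono (λ _ ts″ → subst (λ m → Clocked q u (J m) ts″)
              (sym (+-assoc (⟦ q ⟧ (length u)) _ i))) ≤-refl
            (times-spec q b J B-spec _ t c′))
          0 ts c)

-- Running the given verifier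

module Transfer (w : ℕ) where
  open Programs w
  open Clocks w

  pushed : Word → Tape w
  pushed u = tape (map input u) blank []

  popping : List (Cell w) → Word → Tape w
  popping rs []      = tape [] blank rs
  popping rs (a ∷ u) = tape (map input u) (input a) rs

  popping-pop : ∀ rs a u → act (blank , left) (popping rs (a ∷ u)) ≡ popping (blank ∷ rs) u
  popping-pop rs a []      = refl
  popping-pop rs a (_ ∷ _) = refl

  pushed-left : ∀ u → act (blank , left) (pushed u) ≡ popping (blank ∷ []) u
  pushed-left []      = refl
  pushed-left (_ ∷ _) = refl

  -- The head must not move while the target tape is still empty. Tapes are compared as lists, and
  -- one surplus blank on the right would already differ from `loadTape`.
  room : Cell w → Cell w → Move
  room (input _) (input _) = left
  room _         _         = stay

  makeRoom : Program (single ⊗ single) ⊤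
  makeRoom = prim λ { (s , h) → tt , (s , stay) , (h , room s h) }

  pop : Cell w → Cell w → Bool × Actions (single ⊗ single)
  pop (input a) h = true  , (blank , left) , (input a , stay)
  pop s         h = false , (s , stay) , (h , stay)

  -- The second tape grows to the left, so that it ends up exactly as loadTape.
  transfer : Program (single ⊗ single) Bool
  transfer = makeRoom >> prim λ { (s , h) → pop s h }

  transfer-[] : ∀ {rs t Φ} → Φ false (popping rs [] , t) → ⟨ transfer ⟩ 2 (popping rs [] , t) Φ
  transfer-[] φ = >>-spec {m = 1} (prim-spec (prim-spec φ))

  transfer-∷ : ∀ {rs a u v Φ} → Φ true (popping (blank ∷ rs) u , loadTape (a ∷ v)) →
    ⟨ transfer ⟩ 2 (popping rs (a ∷ u) , loadTape v) Φ
  transfer-∷ {rs} {a} {u} {[]}    {Φ} φ = >>-spec {m = 1} (prim-spec (prim-spec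
    (subst (λ t → Φ true (t , _)) (sym (popping-pop rs a u)) φ)))
  transfer-∷ {rs} {a} {u} {_ ∷ _} {Φ} φ = >>-spec {m = 1} (prim-spec (prim-spec
    (subst (λ t → Φ true (t , _)) (sym (popping-pop rs a u)) φ)))

  continueIf : Bool → Program (single ⊗ single) (⊤ ⊎ ⊤)
  continueIf b = return (if b then inj₁ tt else inj₂ tt)

  transferAll : Program (single ⊗ single) ⊤
  transferAll = loop unit-finite (λ _ → bind bool-finite transfer continueIf) tt

  transferAll-spec : ∀ u {rs v Φ} → (∀ rs′ → Φ tt (popping rs′ [] , loadTape (u ʳ++ v))) →
    ⟨ transferAll ⟩ (suc (length u) * 3) (popping rs u , loadTape v) Φ
  transferAll-spec []      {rs} φ =
      loop-spec {m = 3} (bind-spec {m = 2} (transfer-[] (return-spec (φ rs))))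
  transferAll-spec (a ∷ u) φ = loop-spec {m = 3} (bind-spec {m = 2} (transfer-∷
    (return-spec (transferAll-spec u φ))))

  transferOne : Program (single ⊗ single) ⊤
  transferOne = bind bool-finite transfer (λ _ → return tt)

module Check (M : TuringMachine) (time bound : Polynomial) where
  open TuringMachine M using
      (workSymbols; extraTapes; accepting; initial; run; Halted; Configuration)
  open Programs workSymbols
  open Clocks workSymbols
  open Transfer workSymbols
  open Embed M using (embed; embed-spec)

  final : Word → Word → Configuration
  final y c = run (⟦ time ⟧ (length y + length c)) (initial y c)

  accepts : Word → Word → Bool
  accepts y c = (length c ≤ᵇ ⟦ bound ⟧ (length y)) ∧ accepting (proj₁ (final y c))

  Inner : Shape
  Inner = ((single ⊗ single) ⊗ (single ⊗ single)) ⊗ many extraTapes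

  inputL certificateL : Lens Inner (single ⊗ single)
  inputL .Lens.get (((y , c) , (s , t)) , _)            = y , s
  inputL .Lens.put (y , s) (((_ , c) , (_ , t)) , r)    = ((y , c) , (s , t)) , r
  inputL .Lens.get-put _ _                              = refl
  inputL .Lens.put-put _ _ _                            = refl
  inputL .Lens.put-get _                                = refl
  inputL .Lens.get-map _ _                              = refl
  inputL .Lens.put-zip _ _ _ _                          = refl
  certificateL .Lens.get (((y , c) , (s , t)) , _)         = c , t
  certificateL .Lens.put (c , t) (((y , _) , (s , _)) , r) = ((y , c) , (s , t)) , r
  certificateL .Lens.get-put _ _                           = refl
  certificateL .Lens.put-put _ _ _                         = refl
  certificateL .Lens.put-get _                             = refl
  certificateL .Lens.get-map _ _                           = refl
  certificateL .Lens.put-zip _ _ _ _                       = refl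

  machineL : Lens Inner (Standard (many extraTapes))
  machineL .Lens.get ((_ , v) , r)       = v , r
  machineL .Lens.put (v , r) ((u , _) , _) = (u , v) , r
  machineL .Lens.get-put _ _             = refl
  machineL .Lens.put-put _ _ _           = refl
  machineL .Lens.put-get _               = refl
  machineL .Lens.get-map _ _             = refl
  machineL .Lens.put-zip _ _ _ _         = refl

  lower : Program Inner ⊤
  lower = on (fstL ⨾ fstL) (prim λ _ → tt , (blank , left) , (blank , left))

  judge : Bool → Program Inner Bool
  judge true  = return false
  judge false = on machineL embed

  finish : Program Inner Bool
  finish = bind bool-finite (on (certificateL ⨾ fstL) testInput) judge

  -- `transferOne` gets as many rounds as the bound allows, and rounds on an empty stack do nothing.
  -- A symbol that is left on the certificate stack afterwards shows that the certificate is too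
  -- long, and then the given verifier is not started.
  check : Program (clocked bound Inner) Bool
  check = on (innerL bound Inner) (lower >> on inputL transferAll)
          >> times bound (on certificateL transferOne)
          >> on (innerL bound Inner) finish

  ready : Word → Word → Tapes Inner
  ready y c = ((pushed y , pushed c) , (emptyTape , emptyTape)) , Vec.replicate extraTapes emptyTape

  -- The last condition is the one that decides the length test: as long as symbols remain on the
  -- stack, no round was idle, so exactly `i` symbols have been moved. The inequality before it
  -- covers the case of an empty stack.
  data Copying (x w : Word) (i : ℕ) : Tapes Inner → Set where
    copying : ∀ {t rs} u v → u ʳ++ v ≡ w → length v ≤ i → (0 < length u → length v ≡ i) →
      Copying x w i (((t , popping rs u) , (loadTape x , loadTape v)) ,
          Vec.replicate extraTapes emptyTape)

  transferOne-spec : ∀ x w i ts → Copying x w i ts →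
    ⟨ on certificateL transferOne ⟩ 3 ts (λ _ → Copying x w (suc i))
  transferOne-spec x w i _ (copying [] v eq l≤i _) =
      on-spec (bind-spec {m = 2} (transfer-[] (return-spec
    (copying [] v eq (m≤n⇒m≤1+n l≤i) λ ()))))
  transferOne-spec x w i _ (copying (a ∷ u) v eq l≤i l≡i) =
      on-spec (bind-spec {m = 2} (transfer-∷ (return-spec
    (copying u (a ∷ v) eq (s≤s l≤i) λ _ → cong suc (l≡i (s≤s z≤n))))))

  finishTime : Word → Word → ℕ
  finishTime y c = 1 + suc (⟦ time ⟧ (length y + length c))

  finish-spec : (∀ x c → Halted (final x c)) → ∀ y c ts → Copying y c (⟦ bound ⟧ (length y)) ts →
    ⟨ finish ⟩ (finishTime y c) ts (λ b _ → b ≡ accepts y c)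
  finish-spec halts y c _ (copying [] .c refl l≤b _) =
      bind-spec {m = 1} (on-spec (prim-spec (on-spec
    (embed-spec (⟦ time ⟧ (length y + length c)) (halts y c)
      (cong (_∧ accepting (proj₁ (final y c))) (sym (Equivalence.to T-≡ (≤⇒≤ᵇ l≤b))))))))
  finish-spec halts y .((a ∷ u) ʳ++ v) _ (copying (a ∷ u) v refl l≤b l≡b) =
    bind-spec {m = 1} (on-spec (prim-spec (return-spec (sym (rejected _ refl)))))
    where
    c = (a ∷ u) ʳ++ v
    rejected : ∀ b → (length c ≤ᵇ ⟦ bound ⟧ (length y)) ≡ b →
        b ∧ accepting (proj₁ (final y c)) ≡ false
    rejected false eq = refl
    -- `v` alone has as many symbols as the bound allows, and at least one more is still on the
    -- stack.
    rejected true  eq with ()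
        ← <⇒≱ (subst (suc (⟦ bound ⟧ (length y)) ≤_) (sym (length-ʳ++ (a ∷ u)))
      (s≤s (subst (_≤ length u + length v) (l≡b (s≤s z≤n)) (m≤n+m (length v) (length u)))))
      (≤ᵇ⇒≤ (length c) _ (Equivalence.from T-≡ eq))

  checkTime : ℕ → ℕ → ℕ
  checkTime m n = (1 + suc m * 3) + ⟦ timesTime bound (con 3) ⟧ m + (1 + suc (⟦ time ⟧ (m + n)))

  -- The top of a stack is the symbol pushed last, so unloading it onto a fresh tape reverses it.
  -- The clocks hold `u` and not its reverse, which is harmless because only their length counts.
  check-spec : (∀ x c → Halted (final x c)) → ∀ u v ts → Clocked bound u (_≡ ready u v) ts →
    ⟨ check ⟩ (checkTime (length u) (length v)) ts (λ b _ → b ≡ accepts (reverse u) (reverse v))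
  check-spec halts u v ts c = >>-spec (>>-spec
    (⟨⟩-mono (λ _ ts₁ c₁ →
      ⟨⟩-mono (λ _ ts₂ c₂ →
        ⟨⟩-mono (λ b ts₃ c₃ → Clocked-get bound {J = λ _ → b ≡ accepts (reverse u) (reverse v)} ts₃
            c₃)
          (≤-reflexive (cong₂ (λ m n → 1 + suc (⟦ time ⟧ (m + n))) (length-reverse u)
              (length-reverse v)))
          (inner-spec bound ts₂ (finish-spec halts (reverse u) (reverse v))
            (subst (λ k → Clocked bound u (Copying (reverse u) (reverse v) k) ts₂)
              (trans (+-identityʳ _) (cong ⟦ bound ⟧ (sym (length-reverse u)))) c₂)))
        ≤-refl (times-spec u bound (con 3) (Copying (reverse u) (reverse v))
            (transferOne-spec (reverse u) (reverse v)) 0 ts₁ c₁))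
      ≤-refl
      (inner-spec bound ts (λ { _ refl → >>-spec {m = 1} (on-spec (prim-spec (on-spec
        (subst (λ t → ⟨ transferAll ⟩ _ (t , emptyTape)
            (λ _ → Copying (reverse u) (reverse v) 0 ∘ lowered)) (sym (pushed-left u))
                (transferAll-spec u {v = []} (λ rs′ →
          subst (λ t → Copying (reverse u) (reverse v) 0
                  (((popping rs′ [] , t) , (loadTape (reverse u) , emptyTape)) ,
                      Vec.replicate extraTapes emptyTape))
            (sym (pushed-left v)) (copying v [] refl z≤n λ _ → refl))))))) }) c)))
    where
    lowered : Tapes (single ⊗ single) → Tapes Inner
    lowered t = Lens.put inputL t
      (((act (blank , left) (pushed u) , act (blank , left) (pushed v)) , (emptyTape , emptyTape)) ,
       Vec.replicate extraTapes emptyTape)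

-- Reading the instance and the certificate

Stacks : Set
Stacks = (Word × Word) × (Word × Word)

Pushes : Set
Pushes = (Maybe Symbol × Maybe Symbol) × (Maybe Symbol × Maybe Symbol)

push : Maybe Symbol → Word → Word
push m u = maybe′ (_∷ u) u m

pushAll : Pushes → Stacks → Stacks
pushAll ((my , mc) , (my′ , mc′)) ((y , c) , (y′ , c′)) =
    (push my y , push mc c) , (push my′ y′ , push mc′ c′)

none : Pushes
none = (nothing , nothing) , (nothing , nothing)

toY toC : Bool → Symbol → Pushes
toY false a = (just a , nothing) , (nothing , nothing)
toY true  a = (nothing , nothing) , (just a , nothing)
toC false a = (nothing , just a) , (nothing , nothing)
toC true  a = (nothing , nothing) , (nothing , just a)

digit : Symbol → Bool
digit (bit b) = b
digit sep     = false

isSep : Symbol → Bool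
isSep (bit _) = false
isSep sep     = true

written : Symbol → Maybe Symbol
written (bit b) = just (bit b)
written sep     = nothing

leftDigit rightDigit : Symbol → Pushes
leftDigit  a = (written a , nothing) , (nothing , nothing)
rightDigit a = (nothing , nothing) , (written a , nothing)

bothSep : Pushes
bothSep = (just sep , nothing) , (just sep , nothing)

admissible : Bool → Symbol → Bool
admissible ended a = not ended ∨ isSep a

majority : Bool → Bool → Bool → Bool
majority a b c = (a ∧ b) ∨ (c ∧ (a ∨ b))

agrees : Bool → Bool → Bool → Bool → Bool
agrees s a b c = not (s xor (a xor (b xor c)))

-- The certificate starts with two symbols for each bit of k, the bits of the
-- two summands (sep once a summand has no more bits).  Then there is one bit
-- for each object, and finally the two certificates, each symbol being
-- preceded by a bit that says to which of them it belongs.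
mutual

  number : (carry endedˡ endedʳ last : Bool) → Word → Word → Stacks → Maybe Stacks
  number c e e′ l (sep ∷ x)   w       σ =
      if not c ∧ l then blocks x w (pushAll bothSep σ) else nothing
  number c e e′ l (bit s ∷ x) (a ∷ w) σ =
    if admissible e a then number′ c (isSep a) e′ (digit a) (bit s ∷ x) w
        (pushAll (leftDigit a) σ) else nothing
  number c e e′ l (bit s ∷ x) []      σ = nothing
  number c e e′ l []          w       σ = nothing

  number′ : (carry endedˡ endedʳ a : Bool) → Word → Word → Stacks → Maybe Stacks
  number′ c e e′ a (bit s ∷ x) (b ∷ w) σ =
    if admissible e′ b ∧ agrees s a (digit b) c
    then number (majority a (digit b) c) e (isSep b) s x w (pushAll (rightDigit b) σ) else nothing
  number′ c e e′ a (bit s ∷ x) []      σ = nothing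
  number′ c e e′ a (sep ∷ x)   w       σ = nothing
  number′ c e e′ a []          w       σ = nothing

  blocks : Word → Word → Stacks → Maybe Stacks
  blocks []      w           σ = tagged w σ
  blocks (a ∷ x) (bit d ∷ w) σ = block d (a ∷ x) w σ
  blocks (a ∷ x) (sep ∷ w)   σ = nothing
  blocks (a ∷ x) []          σ = nothing

  block : Bool → Word → Word → Stacks → Maybe Stacks
  block d (bit b ∷ x) w σ = block d x w (pushAll (toY d (bit b)) σ)
  block d (sep ∷ x)   w σ = blocks x w (pushAll (toY d sep) σ)
  block d []          w σ = nothing

  tagged : Word → Stacks → Maybe Stacks
  tagged []          σ = just σ
  tagged (bit d ∷ w) σ = value d w σ
  tagged (sep ∷ w)   σ = nothing

  value : Bool → Word → Stacks → Maybe Stacks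
  value d (a ∷ w) σ = tagged w (pushAll (toC d a) σ)
  value d []      σ = nothing

parse : Word → Word → Maybe Stacks
parse x w = number false false false true x w (([] , []) , ([] , []))

Phase : Set
Phase = (Bool × Bool × Bool × Bool) ⊎ (Bool × Bool × Bool × Bool) ⊎ ⊤ ⊎ Bool ⊎ ⊤ ⊎ Bool

pattern inNumber c e e′ l  = inj₁ (c , e , e′ , l)
pattern inNumber′ c e e′ a = inj₂ (inj₁ (c , e , e′ , a))
pattern inBlocks           = inj₂ (inj₂ (inj₁ tt))
pattern inBlock d          = inj₂ (inj₂ (inj₂ (inj₁ d)))
pattern inTagged           = inj₂ (inj₂ (inj₂ (inj₂ (inj₁ tt))))
pattern inValue d          = inj₂ (inj₂ (inj₂ (inj₂ (inj₂ d))))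

phase-finite : Finite Phase
phase-finite = ⊎-finite four (⊎-finite four (⊎-finite unit-finite (⊎-finite bool-finite
  (⊎-finite unit-finite bool-finite))))
  where
  four : Finite (Bool × Bool × Bool × Bool)
  four = Σ-finite bool-finite λ _ → Σ-finite bool-finite λ _ → Σ-finite bool-finite λ _ →
      bool-finite

-- The two Booleans say which of the two words to advance.
Response : Set
Response = (Phase ⊎ Bool) × (Bool × Bool) × Pushes

reject : Response
reject = inj₂ false , (false , false) , none

-- The table restates the word functions above in terms of the two symbols under the heads. The step
-- for the first digit does not advance on the instance, since the bit of `k` is compared only when
-- the second digit is known.
respond : Phase → Maybe Symbol → Maybe Symbol → Response
respond (inNumber c e e′ l)  (just sep)     _              =
  if not c ∧ l then (inj₁ inBlocks , (true , false) , bothSep) else reject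
respond (inNumber c e e′ l)  (just (bit s)) (just a)       =
  if admissible e a then (inj₁ (inNumber′ c (isSep a) e′ (digit a)) , (false , true) , leftDigit a)
      else reject
respond (inNumber′ c e e′ a) (just (bit s)) (just b)       =
  if admissible e′ b ∧ agrees s a (digit b) c
  then (inj₁ (inNumber (majority a (digit b) c) e (isSep b) s) , (true , true) , rightDigit b) else
      reject
respond inBlocks             nothing        _              = inj₁ inTagged , (false , false) , none
respond inBlocks             (just _)       (just (bit d)) =
    inj₁ (inBlock d) , (false , true) , none
respond (inBlock d)          (just (bit b)) _              =
    inj₁ (inBlock d) , (true , false) , toY d (bit b)
respond (inBlock d)          (just sep)     _              =
    inj₁ inBlocks , (true , false) , toY d sep
respond inTagged             _              nothing        = inj₂ true , (false , false) , none
respond inTagged             _              (just (bit d)) =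
    inj₁ (inValue d) , (false , true) , none
respond (inValue d)          _              (just a)       =
    inj₁ inTagged , (false , true) , toC d a
respond _                    _              _              = reject

-- The parser as an automaton

module Parser (M : TuringMachine) (time bound : Polynomial) where
  open TuringMachine M using (workSymbols; extraTapes)
  open Programs workSymbols
  open Clocks workSymbols
  open Transfer workSymbols
  open Check M time bound using (Inner; ready)

  fill : ∀ p {T X} → X → Arr T X → Arr (clocked p T) X
  fill (con a)  x a′ = a′
  fill var      x a′ = x , a′
  fill (p :+ q) {T} x a′ = fill p {clocked q T} x (fill q x a′)
  fill (p :* q) {T} x a′ = fill p {clocked q T} x (fill q x a′)

  fill-zip : ∀ p {T X Y Z} (f : X → Y → Z) x y s t →
    zipA (clocked p T) f (fill p x s) (fill p y t) ≡ fill p (f x y) (zipA T f s t)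
  fill-zip (con a)  f x y s t = refl
  fill-zip var      f x y s t = refl
  fill-zip (p :+ q) {T} f x y s t =
    trans (fill-zip p {clocked q T} f x y _ _)
        (cong (fill p {clocked q T} _) (fill-zip q f x y s t))
  fill-zip (p :* q) {T} f x y s t =
    trans (fill-zip p {clocked q T} f x y _ _)
        (cong (fill p {clocked q T} _) (fill-zip q f x y s t))

  fill-pure : ∀ p {T X} (x : X) → pureA (clocked p T) x ≡ fill p x (pureA T x)
  fill-pure (con a)  x = refl
  fill-pure var      x = refl
  fill-pure (p :+ q) {T} x =
      trans (fill-pure p {clocked q T} x) (cong (fill p {clocked q T} x) (fill-pure q x))
  fill-pure (p :* q) {T} x =
      trans (fill-pure p {clocked q T} x) (cong (fill p {clocked q T} x) (fill-pure q x))

  fill-clocked : ∀ p {T u} {J : Tapes T → Set} {t} → J t → Clocked p u J (fill p (pushed u) t)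
  fill-clocked (con a)  j = j
  fill-clocked var {u = u} j = (0 , [] , cong (λ ls → tape ls blank []) (sym (++-identityʳ _))) , j
  fill-clocked (p :+ q) {T} {u} {J} j =
      fill-clocked p {clocked q T} {u} {Clocked q u J} (fill-clocked q {J = J} j)
  fill-clocked (p :* q) {T} {u} {J} j =
      fill-clocked p {clocked q T} {u} {Clocked q u J} (fill-clocked q {J = J} j)

  Side Whole : Shape
  Side  = clocked bound Inner
  Whole = Standard (Side ⊗ Side)

  side : Word × Word → Tapes Side
  side (y , c) = fill bound (pushed y) (ready y c)

  sides : Stacks → Tapes (Side ⊗ Side)
  sides (l , r) = side l , side r

  pushAct : Maybe Symbol → Cell workSymbols × Move
  pushAct nothing  = blank , stay
  pushAct (just a) = input a , right

  act-push : ∀ m u → act (pushAct m) (pushed u) ≡ pushed (push m u)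
  act-push nothing  u = refl
  act-push (just a) u = refl

  -- Each symbol of an instance is pushed on all clocks of its side as well. The counters of the
  -- loop nest are therefore loaded by the time parsing ends.
  sideActs : Maybe Symbol × Maybe Symbol → Actions Side
  sideActs (my , mc) = fill bound (pushAct my)
    (((pushAct my , pushAct mc) , ((blank , stay) , (blank , stay))) , Vec.replicate extraTapes
        (blank , stay))

  sides-push : ∀ ps σ → perform (Side ⊗ Side) (sideActs (proj₁ ps) , sideActs (proj₂ ps))
      (sides σ) ≡
    sides (pushAll ps σ)
  sides-push (pl , pr) (l , r) = cong₂ _,_ (side-push pl l) (side-push pr r)
    where
    side-push : ∀ ps u → perform Side (sideActs ps) (side u) ≡
      side (push (proj₁ ps) (proj₁ u) , push (proj₂ ps) (proj₂ u))
    side-push (my , mc) (y , c)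
      rewrite fill-zip bound {Inner} act (pushAct my) (pushed y)
                (((pushAct my , pushAct mc) , ((blank , stay) , (blank , stay))) ,
                    Vec.replicate extraTapes (blank , stay))
                (ready y c)
            | act-push my y | act-push mc c
            | Vecₚ.zipWith-replicate {n = extraTapes} (act {workSymbols}) (blank , stay) emptyTape =
                refl

  symbol : Cell workSymbols → Maybe Symbol
  symbol (input a) = just a
  symbol _         = nothing

  moveIf : Bool → Move
  moveIf b = if b then right else stay

  parser : Automaton Whole Bool
  parser .Automaton.State  = Phase
  parser .Automaton.finite = phase-finite
  parser .Automaton.δ q ((a , b) , _) = let r , (m , m′) , pl , pr = respond q (symbol a) (symbol b) in
    r , ((a , moveIf m) , (b , moveIf m′)) , sideActs pl , sideActs pr

  parseProgram : Program Whole Bool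
  parseProgram = record { automaton = parser ; start = inNumber false false false true }

  reading : List (Cell workSymbols) → Word → Tape workSymbols
  reading ls u = at ls (map input u)

  advance : Bool → Word → Word
  advance true  u = List.drop 1 u
  advance false u = u

  passed : Bool → List (Cell workSymbols) → Word → List (Cell workSymbols)
  passed true  ls u = Tape.head (reading ls u) ∷ ls
  passed false ls u = ls

  symbol-reading : ∀ ls u → symbol (Tape.head (reading ls u)) ≡ List.head u
  symbol-reading ls []      = refl
  symbol-reading ls (_ ∷ _) = refl

  reading-advance : ∀ b ls u → act (Tape.head (reading ls u) , moveIf b) (reading ls u) ≡
    reading (passed b ls u) (advance b u)
  reading-advance false ls u           = refl
  reading-advance true  ls []          = refl
  reading-advance true  ls (a ∷ u)     = moveHead-right ls (input a) (map input u)

  conf : List (Cell workSymbols) → List (Cell workSymbols) → Word → Word → Stacks → Tapes Whole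
  conf ls ls′ x w σ = (reading ls x , reading ls′ w) , sides σ

  data Parsed : Maybe Stacks → Post Whole Bool where
    rejected : ∀ {ts} → Parsed nothing false ts
    parsed   : ∀ {σ t} → Parsed (just σ) true (t , sides σ)

  -- The bridge from words to tapes: since a response depends only on the first symbols of the two
  -- words, each clause of the word functions becomes exactly one step, given by an equation about
  -- `respond`.
  respond-step : ∀ {q ls ls′ x w σ m n Φ r b b′ ps} →
    respond q (List.head x) (List.head w) ≡ (r , (b , b′) , ps) → m ≤ n →
    Continues parser Φ m r (conf (passed b ls x) (passed b′ ls′ w) (advance b x) (advance b′ w)
        (pushAll ps σ)) →
    Runs parser Φ (suc n) q (conf ls ls′ x w σ)
  respond-step {q} {ls} {ls′} {x} {w} {σ} {m} {n} {Φ} {r} {b} {b′} {ps} eq m≤n k = step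
    (subst₂ (Continues parser Φ n) (sym (cong proj₁ eq′))
      (cong₂ _,_ (cong₂ _,_
          (sym (trans (cong (λ c → act (Tape.head (reading ls x) , moveIf (proj₁ (proj₁ (proj₂ c))))
              (reading ls x)) eq′) (reading-advance b ls x)))
                            (sym (trans (cong (λ c →
                                act (Tape.head (reading ls′ w) , moveIf (proj₂ (proj₁ (proj₂ c))))
                                    (reading ls′ w)) eq′) (reading-advance b′ ls′ w))))
                 (sym (trans (cong (λ c →
                     perform (Side ⊗ Side)
                         (sideActs (proj₁ (proj₂ (proj₂ c))) , sideActs (proj₂ (proj₂ (proj₂ c))))
                             (sides σ)) eq′) (sides-push ps σ))))
      (Continues-mono (λ _ _ → id) m≤n k))
    where
    eq′ : respond q (symbol (Tape.head (reading ls x))) (symbol (Tape.head (reading ls′ w))) ≡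
        (r , (b , b′) , ps)
    eq′ = trans (cong₂ (respond q) (symbol-reading ls x) (symbol-reading ls′ w)) eq

  reject-step : ∀ {q ls ls′ x w σ n} → respond q (List.head x) (List.head w) ≡ reject →
    Runs parser (Parsed nothing) (suc n) q (conf ls ls′ x w σ)
  reject-step {q} {ls} {ls′} {x} {w} {σ} eq =
    respond-step {q} {ls} {ls′} {x} {w} {σ} {m = 0} eq z≤n (exited rejected)

  shorter : ∀ (x w : Word) {a : Symbol} →
      2 + (length x + length w) ≤ suc (length x + length (a ∷ w))
  shorter x w = s≤s (≤-reflexive (sym (+-suc (length x) (length w))))

  mutual

    -- Every step consumes a symbol, except the passage from `inBlocks` to `inTagged` and the final
    -- exit. These two are the constant in the bound.
    number-runs : ∀ c e e′ l x w {σ ls ls′} →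
      Runs parser (Parsed (number c e e′ l x w σ)) (2 + (length x + length w)) (inNumber c e e′ l)
          (conf ls ls′ x w σ)
    number-runs c e e′ l (sep ∷ x) w {σ} {ls} {ls′} with not c ∧ l in eq
    ... | true  = respond-step {x = sep ∷ x} (cong (λ b → if b then _ else reject) eq) ≤-refl
        (running (blocks-runs x w))
    ... | false = reject-step {x = sep ∷ x} (cong (λ b → if b then _ else reject) eq)
    number-runs c e e′ l (bit s ∷ x) (a ∷ w) with admissible e a in eq
    ... | true  = respond-step {x = bit s ∷ x} {a ∷ w} (cong (λ b → if b then _ else reject) eq)
        (shorter (bit s ∷ x) w {a})
                    (running (number′-runs c (isSep a) e′ (digit a) (bit s ∷ x) w))
    ... | false = reject-step {x = bit s ∷ x} {a ∷ w} (cong (λ b → if b then _ else reject) eq)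
    number-runs c e e′ l (bit s ∷ x) [] = reject-step {x = bit s ∷ x} {[]} refl
    number-runs c e e′ l []          w  = reject-step {x = []} {w} refl

    number′-runs : ∀ c e e′ a x w {σ ls ls′} →
      Runs parser (Parsed (number′ c e e′ a x w σ)) (2 + (length x + length w)) (inNumber′ c e e′ a)
          (conf ls ls′ x w σ)
    number′-runs c e e′ a (bit s ∷ x) (b ∷ w) with admissible e′ b ∧ agrees s a (digit b) c in eq
    ... | true  = respond-step {x = bit s ∷ x} {b ∷ w} (cong (λ b → if b then _ else reject) eq)
                    (≤-trans (shorter x w {b}) (n≤1+n _))
                    (running (number-runs (majority a (digit b) c) e (isSep b) s x w))
    ... | false = reject-step {x = bit s ∷ x} {b ∷ w} (cong (λ b → if b then _ else reject) eq)
    number′-runs c e e′ a (bit s ∷ x) [] = reject-step {x = bit s ∷ x} {[]} refl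
    number′-runs c e e′ a (sep ∷ x)   w  = reject-step {x = sep ∷ x} {w} refl
    number′-runs c e e′ a []          w  = reject-step {x = []} {w} refl

    blocks-runs : ∀ x w {σ ls ls′} →
      Runs parser (Parsed (blocks x w σ)) (2 + (length x + length w)) inBlocks (conf ls ls′ x w σ)
    blocks-runs []      w           =
        respond-step {x = []} {w} refl ≤-refl (running (tagged-runs [] w))
    blocks-runs (a ∷ x) (bit d ∷ w) =
        respond-step {x = a ∷ x} {bit d ∷ w} refl (shorter (a ∷ x) w {bit d})
                                        (running (block-runs d (a ∷ x) w))
    blocks-runs (a ∷ x) (sep ∷ w)   = reject-step {x = a ∷ x} {sep ∷ w} refl
    blocks-runs (a ∷ x) []          = reject-step {x = a ∷ x} {[]} refl

    block-runs : ∀ d x w {σ ls ls′} →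
      Runs parser (Parsed (block d x w σ)) (2 + (length x + length w)) (inBlock d)
          (conf ls ls′ x w σ)
    block-runs d (bit b ∷ x) w =
        respond-step {x = bit b ∷ x} {w} refl ≤-refl (running (block-runs d x w))
    block-runs d (sep ∷ x)   w =
        respond-step {x = sep ∷ x} {w} refl ≤-refl (running (blocks-runs x w))
    block-runs d []          w = reject-step {x = []} {w} refl

    tagged-runs : ∀ x w {σ ls ls′} →
      Runs parser (Parsed (tagged w σ)) (1 + length w) inTagged (conf ls ls′ x w σ)
    tagged-runs x []          = respond-step {x = x} {[]} {m = 0} (tagged-[] x) z≤n (exited parsed)
      where
      tagged-[] : ∀ x → respond inTagged (List.head x) nothing ≡
          (inj₂ true , (false , false) , none)
      tagged-[] []      = refl
      tagged-[] (_ ∷ _) = refl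
    tagged-runs x (bit d ∷ w) =
        respond-step {x = x} {bit d ∷ w} refl ≤-refl (running (value-runs d x w))
    tagged-runs x (sep ∷ w)   = reject-step {x = x} {sep ∷ w} refl

    value-runs : ∀ d x w {σ ls ls′} →
      Runs parser (Parsed (value d w σ)) (1 + length w) (inValue d) (conf ls ls′ x w σ)
    value-runs d x (a ∷ w) = respond-step {x = x} {a ∷ w} refl ≤-refl (running (tagged-runs x w))
    value-runs d x []      = reject-step {x = x} {[]} refl

  parse-spec : ∀ x w → ⟨ parseProgram ⟩ (2 + (length x + length w))
    ((loadTape x , loadTape w) , pureA (Side ⊗ Side) emptyTape) (Parsed (parse x w))
  parse-spec x w = started
      (subst (Runs parser (Parsed (parse x w)) _ (inNumber false false false true))
    (cong₂ _,_ (cong₂ _,_ (reading-load x) (reading-load w)) (cong₂ _,_ side-pure side-pure))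
    (number-runs false false false true x w))
    where
    reading-load : ∀ u → reading [] u ≡ loadTape u
    reading-load []      = refl
    reading-load (_ ∷ _) = refl

    side-pure : side ([] , []) ≡ pureA Side emptyTape
    side-pure = sym (fill-pure bound {Inner} emptyTape)

-- Binary numbers and encodings

weight : Bool → ℕ
weight b = if b then 1 else 0

valueOf : List Bool → ℕ
valueOf []       = 0
valueOf (b ∷ bs) = weight b + 2 * valueOf bs

-- canonical l bs says that l ∷ bs does not end with a superfluous zero.
canonical : Bool → List Bool → Bool
canonical l []       = l
canonical l (b ∷ bs) = canonical b bs

canonical-weaken : ∀ l bs → canonical l bs ≡ true → canonical true bs ≡ true
canonical-weaken l []       c = refl
canonical-weaken l (b ∷ bs) c = c

canonical-increment : ∀ l bs → canonical true bs ≡ true → canonical l (increment bs) ≡ true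
canonical-increment l []           c = refl
canonical-increment l (false ∷ bs) c = canonical-weaken false bs c
canonical-increment l (true ∷ bs)  c = canonical-increment false bs c

canonical-binary : ∀ n → canonical true (binary n) ≡ true
canonical-binary zero    = refl
canonical-binary (suc n) = canonical-increment true (binary n) (canonical-binary n)

valueOf-increment : ∀ bs → valueOf (increment bs) ≡ suc (valueOf bs)
valueOf-increment []           = refl
valueOf-increment (false ∷ bs) = refl
valueOf-increment (true ∷ bs)  = trans (cong (2 *_) (valueOf-increment bs)) (*-suc 2 (valueOf bs))

valueOf-binary : ∀ n → valueOf (binary n) ≡ n
valueOf-binary zero    = refl
valueOf-binary (suc n) = trans (valueOf-increment (binary n)) (cong suc (valueOf-binary n))

parity-unique : ∀ a b {m n} → weight a + 2 * m ≡ weight b + 2 * n → a ≡ b × m ≡ n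
parity-unique false false         eq = refl , *-cancelˡ-≡ _ _ 2 eq
parity-unique true  true          eq = refl , *-cancelˡ-≡ _ _ 2 (+-cancelˡ-≡ 1 _ _ eq)
parity-unique false true  {m} {n} eq = contradiction eq (even≢odd m n)
parity-unique true  false {m} {n} eq = contradiction (sym eq) (even≢odd n m)

valueOf-positive : ∀ bs → canonical false bs ≡ true → 0 < valueOf bs
valueOf-positive (true ∷ bs)  c = s≤s z≤n
valueOf-positive (false ∷ bs) c = ≤-trans (valueOf-positive bs c) (m≤m+n _ _)

valueOf-injective : ∀ as bs → canonical true as ≡ true → canonical true bs ≡ true →
  valueOf as ≡ valueOf bs → as ≡ bs
valueOf-injective []           []           ca cb eq = refl
valueOf-injective []           (false ∷ bs) ca cb eq =
    contradiction eq (<⇒≢ (valueOf-positive (false ∷ bs) cb))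
valueOf-injective (false ∷ as) []           ca cb eq =
    contradiction (sym eq) (<⇒≢ (valueOf-positive (false ∷ as) ca))
valueOf-injective (a ∷ as)     (b ∷ bs)     ca cb eq with refl , eq′ ← parity-unique a b eq =
  cong (a ∷_) (valueOf-injective as bs (canonical-weaken a as ca) (canonical-weaken a bs cb) eq′)

binary-valueOf : ∀ bs → canonical true bs ≡ true → binary (valueOf bs) ≡ bs
binary-valueOf bs c =
    valueOf-injective _ bs (canonical-binary (valueOf bs)) c (valueOf-binary (valueOf bs))

double-≤ : ∀ a b {m n} → weight a + 2 * m ≤ weight b + 2 * n → m ≤ n
double-≤ a b {m} {n} le = ≤-pred (*-cancelˡ-< 2 m (suc n) (begin-strict
  2 * m             ≤⟨ m≤n+m _ (weight a) ⟩
  weight a + 2 * m  ≤⟨ le ⟩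
  weight b + 2 * n  <⟨ +-monoˡ-< (2 * n) (weight<2 b) ⟩
  2 + 2 * n         ≡⟨ sym (*-suc 2 n) ⟩
  2 * suc n         ∎))
  where
  open ≤-Reasoning
  weight<2 : ∀ b → weight b < 2
  weight<2 false = s≤s z≤n
  weight<2 true  = s≤s (s≤s z≤n)

-- The certificate offers one place per bit of `k` for the digits of each summand. Canonicity
-- ensures that a summand, being at most `k`, fits into these places.
canonical-length : ∀ as bs → canonical true as ≡ true → valueOf as ≤ valueOf bs →
    length as ≤ length bs
canonical-length []           bs       c le = z≤n
canonical-length (false ∷ as) []       c le =
    contradiction le (<⇒≱ (valueOf-positive (false ∷ as) c))
canonical-length (a ∷ as)     (b ∷ bs) c le =
  s≤s (canonical-length as bs (canonical-weaken a as c) (double-≤ a b le))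

twice : List Bool → List Bool
twice []       = []
twice (b ∷ bs) = false ∷ b ∷ bs

valueOf-twice : ∀ bs → valueOf (twice bs) ≡ valueOf bs + valueOf bs
valueOf-twice []       = refl
valueOf-twice (b ∷ bs) = cong (valueOf (b ∷ bs) +_) (+-identityʳ _)

canonical-twice : ∀ bs → canonical true (twice bs) ≡ canonical true bs
canonical-twice []       = refl
canonical-twice (b ∷ bs) = refl

binary-double : ∀ n → binary (n + n) ≡ twice (binary n)
binary-double n = trans
    (cong binary (trans (sym (cong₂ _+_ (valueOf-binary n) (valueOf-binary n)))
        (sym (valueOf-twice (binary n)))))
  (binary-valueOf (twice (binary n)) (trans (canonical-twice (binary n)) (canonical-binary n)))

binary-half : ∀ bs n → twice bs ≡ binary n → ∃[ m ] binary m ≡ bs × m + m ≡ n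
binary-half bs n eq = valueOf bs ,
  binary-valueOf bs (trans (sym (canonical-twice bs))
      (trans (cong (canonical true) eq) (canonical-binary n))) ,
  trans (sym (valueOf-twice bs)) (trans (cong valueOf eq) (valueOf-binary n))

blockWord : List (List Bool) → Word
blockWord []       = []
blockWord (u ∷ us) = map bit u ++ sep ∷ blockWord us

instanceWord : List Bool → List (List Bool) → Word
instanceWord bs us = map bit bs ++ sep ∷ blockWord us

sep-injective : ∀ u v {x y} → map bit u ++ sep ∷ x ≡ map bit v ++ sep ∷ y → u ≡ v × x ≡ y
sep-injective []       []       refl = refl , refl
sep-injective (a ∷ u) (b ∷ v) eq with refl ← ∷-injectiveˡ eq | refl , eq′ ← sep-injective u v
    (∷-injectiveʳ eq) = refl , eq′

blockWord-injective : ∀ us vs → blockWord us ≡ blockWord vs → us ≡ vs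
blockWord-injective []             []             eq = refl
blockWord-injective []             ([] ∷ vs)      ()
blockWord-injective []             ((_ ∷ _) ∷ vs) ()
blockWord-injective ([] ∷ us)      []             ()
blockWord-injective ((_ ∷ _) ∷ us) []             ()
blockWord-injective (u ∷ us)       (v ∷ vs)       eq with refl , eq′ ← sep-injective u v eq =
  cong (u ∷_) (blockWord-injective us vs eq′)

blockWord-++ : ∀ us vs → blockWord (us ++ vs) ≡ blockWord us ++ blockWord vs
blockWord-++ []       vs = refl
blockWord-++ (u ∷ us) vs = trans (cong (λ w → map bit u ++ sep ∷ w) (blockWord-++ us vs))
  (sym (++-assoc (map bit u) (sep ∷ blockWord us) (blockWord vs)))

data Separated : Word → Set where
  unseparated : ∀ u → Separated (map bit u)
  separated   : ∀ u x → Separated (map bit u ++ sep ∷ x)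

separate : ∀ x → Separated x
separate []          = unseparated []
separate (sep ∷ x)   = separated [] x
separate (bit b ∷ x) with separate x
... | unseparated u = unseparated (b ∷ u)
... | separated u y = separated (b ∷ u) y

unseparated≢ : ∀ u v {x} → map bit u ≢ map bit v ++ sep ∷ x
unseparated≢ []       []      ()
unseparated≢ (a ∷ u) (b ∷ v) eq = unseparated≢ u v (∷-injectiveʳ eq)

-- This asks whether the last symbol is a separator, `f` being the answer for the empty word. With
-- `true` for `f` it characterises the words that consist of complete blocks.
finished : Bool → Word → Bool
finished f []      = f
finished f (a ∷ x) = finished (isSep a) x

finished-++ : ∀ f x y → finished f (x ++ y) ≡ finished (finished f x) y
finished-++ f []      y = refl
finished-++ f (a ∷ x) y = finished-++ (isSep a) x y

finished-blockWord : ∀ us → finished true (blockWord us) ≡ true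
finished-blockWord []       = refl
finished-blockWord (u ∷ us) =
    trans (finished-++ true (map bit u) (sep ∷ blockWord us)) (finished-blockWord us)

finished-square : ∀ x → finished true (x ++ x) ≡ finished true x
finished-square []      = refl
finished-square (a ∷ x) = finished-++ (isSep a) x (a ∷ x)

mutual

  finished⇒blocks : ∀ x → finished true x ≡ true → ∃[ us ] x ≡ blockWord us
  finished⇒blocks []          f = [] , refl
  finished⇒blocks (sep ∷ x)   f with us , refl ← finished⇒blocks x f = [] ∷ us , refl
  finished⇒blocks (bit b ∷ x) f with u , us , refl ← unfinished⇒blocks x f = (b ∷ u) ∷ us , refl

  unfinished⇒blocks : ∀ x → finished false x ≡ true →
      ∃[ u ] ∃[ us ] x ≡ map bit u ++ sep ∷ blockWord us
  unfinished⇒blocks (sep ∷ x)   f with us , refl ← finished⇒blocks x f = [] , us , refl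
  unfinished⇒blocks (bit b ∷ x) f with u , us , refl ← unfinished⇒blocks x f = b ∷ u , us , refl

-- `x` and `x ++ x` end in the same symbol, so `finished` transfers from the square to `x`; after
-- that, injectivity of `blockWord` compares the two lists of blocks.
blockWord-halve : ∀ x us → x ++ x ≡ blockWord us → ∃[ vs ] x ≡ blockWord vs × us ≡ vs ++ vs
blockWord-halve x us eq
  with vs , refl ← finished⇒blocks x
      (trans (sym (finished-square x)) (trans (cong (finished true) eq) (finished-blockWord us))) =
  vs , refl , blockWord-injective us (vs ++ vs) (trans (sym eq) (sym (blockWord-++ vs vs)))

-- Soundness and completeness of the parser

full-adder : ∀ a b c → weight a + weight b + weight c ≡ weight (a xor (b xor c)) + 2 * weight
    (majority a b c)
full-adder false false false = refl
full-adder false false true  = refl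
full-adder false true  false = refl
full-adder false true  true  = refl
full-adder true  false false = refl
full-adder true  false true  = refl
full-adder true  true  false = refl
full-adder true  true  true  = refl

column : ∀ a b c m n → (weight a + 2 * m) + (weight b + 2 * n) + weight c ≡
  weight (a xor (b xor c)) + 2 * (m + n + weight (majority a b c))
column a b c m n = begin
  (weight a + 2 * m) + (weight b + 2 * n) + weight c ≡⟨ solve 5 (λ a b c m n →
      (a :+′ con′ 2 :*′ m) :+′ (b :+′ con′ 2 :*′ n) :+′ c := (a :+′ b :+′ c) :+′ con′ 2 :*′
          (m :+′ n)) refl (weight a) (weight b) (weight c) m n ⟩
  (weight a + weight b + weight c) + 2 * (m + n) ≡⟨ cong (_+ 2 * (m + n)) (full-adder a b c) ⟩
  (weight (a xor (b xor c)) + 2 * weight (majority a b c)) + 2 * (m + n) ≡⟨ solve 3 (λ s j k →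
      (s :+′ con′ 2 :*′ j) :+′ con′ 2 :*′ k := s :+′ con′ 2 :*′ (k :+′ j)) refl
          (weight (a xor (b xor c))) (weight (majority a b c)) (m + n) ⟩
  weight (a xor (b xor c)) + 2 * (m + n + weight (majority a b c)) ∎
  where
  open ≡-Reasoning
  open +-*-Solver using (solve; _:=_) renaming (_:+_ to _:+′_; _:*_ to _:*′_; con to con′)

agrees⇒≡ : ∀ s a b c → agrees s a b c ≡ true → s ≡ a xor (b xor c)
agrees⇒≡ s a b c = equal s (a xor (b xor c))
  where
  equal : ∀ s t → not (s xor t) ≡ true → s ≡ t
  equal false false _ = refl
  equal true  true  _ = refl

agrees-refl : ∀ s a b c → s ≡ a xor (b xor c) → agrees s a b c ≡ true
agrees-refl s a b c refl = xor-same (a xor (b xor c))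
  where
  xor-same : ∀ s → not (s xor s) ≡ true
  xor-same false = refl
  xor-same true  = refl

-- The invariant for the bits of `k` that are still to be read. The pending carry enters `sum` as a
-- third summand, `as` and `bs` are the digits still to come, and `continued` records the situation
-- in which the blocks are reached.
record NumberParsed (c e e′ l : Bool) (x : Word) (σ τ : Stacks) : Set where
  constructor numberParsed
  field
    s as bs   : List Bool
    rest cert : Word
    input≡    : x ≡ map bit s ++ sep ∷ rest
    sum       : valueOf s ≡ valueOf as + valueOf bs + weight c
    canon     : canonical l s ≡ true
    ended     : e ≡ true → as ≡ []
    ended′    : e′ ≡ true → bs ≡ []
    continued : blocks rest cert ((sep ∷ (map bit as ʳ++ proj₁ (proj₁ σ)) , proj₂ (proj₁ σ)) ,
                                  (sep ∷ (map bit bs ʳ++ proj₁ (proj₂ σ)) , proj₂ (proj₂ σ))) ≡ just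
                                      τ

if-just : ∀ {A : Set} b {m : Maybe A} {a} → (if b then m else nothing) ≡ just a →
    b ≡ true × m ≡ just a
if-just true eq = refl , eq

consDigit : Symbol → List Bool → List Bool
consDigit (bit b) bs = b ∷ bs
consDigit sep     bs = bs

-- A separator stands for the digit zero although it adds no digit; the equation survives because
-- nothing may follow it.
valueOf-consDigit : ∀ a as → (isSep a ≡ true → as ≡ []) →
    valueOf (consDigit a as) ≡ weight (digit a) + 2 * valueOf as
valueOf-consDigit (bit _) as e = refl
valueOf-consDigit sep     as e rewrite e refl = refl

push-consDigit : ∀ a as u → map bit as ʳ++ push (written a) u ≡ map bit (consDigit a as) ʳ++ u
push-consDigit (bit _) as u = refl
push-consDigit sep     as u = refl

ended-consDigit : ∀ e a as → admissible e a ≡ true → (isSep a ≡ true → as ≡ []) → e ≡ true →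
    consDigit a as ≡ []
ended-consDigit true sep as adm e refl = e refl

number-sound : ∀ c e e′ l x w σ {τ} → number c e e′ l x w σ ≡ just τ → NumberParsed c e e′ l x σ τ
number-sound false e e′ true (sep ∷ x) w σ eq =
    numberParsed [] [] [] x w refl refl refl (λ _ → refl) (λ _ → refl) eq
number-sound c e e′ l (bit s ∷ x) (a ∷ b ∷ w) σ eq
  with adm , eq₁ ← if-just (admissible e a) eq
  with ok , eq₂ ← if-just (admissible e′ b ∧ agrees s (digit a) (digit b) c) eq₁
  with numberParsed s′ as bs rest cert refl sum canon ended ended′ continued ←
         number-sound (majority (digit a) (digit b) c) (isSep a) (isSep b) s x w _ eq₂ =
  numberParsed (s ∷ s′) (consDigit a as) (consDigit b bs) rest cert refl
    (trans (cong₂ (λ t v → weight t + 2 * v)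
        (agrees⇒≡ s (digit a) (digit b) c (∧-conicalʳ (admissible e′ b) _ ok)) sum)
      (trans (sym (column (digit a) (digit b) c (valueOf as) (valueOf bs)))
        (cong₂ (λ m n → m + n + weight c) (sym (valueOf-consDigit a as ended))
            (sym (valueOf-consDigit b bs ended′)))))
    canon
    (ended-consDigit e a as adm ended)
    (ended-consDigit e′ b bs (∧-conicalˡ _ _ ok) ended′)
    (trans (cong₂ (λ u v → blocks rest cert ((sep ∷ u , _) , (sep ∷ v , _)))
             (sym (push-consDigit a as (proj₁ (proj₁ σ))))
                 (sym (push-consDigit b bs (proj₁ (proj₂ σ))))) continued)
number-sound c e e′ l (bit s ∷ x) (a ∷ []) σ eq with () ← proj₂ (if-just (admissible e a) eq)

digits : List Bool → Symbol
digits []      = sep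
digits (b ∷ _) = bit b

numberCertificate : List Bool → List Bool → List Bool → Word
numberCertificate []      as bs = []
numberCertificate (_ ∷ s) as bs =
    digits as ∷ digits bs ∷ numberCertificate s (List.drop 1 as) (List.drop 1 bs)

length-numberCertificate : ∀ s as bs → length (numberCertificate s as bs) ≡ 2 * length s
length-numberCertificate []      as bs = refl
length-numberCertificate (_ ∷ s) as bs =
  trans (cong (2 +_) (length-numberCertificate s (List.drop 1 as) (List.drop 1 bs)))
      (sym (*-suc 2 (length s)))

admissible-digits : ∀ e as → (e ≡ true → as ≡ []) → admissible e (digits as) ≡ true
admissible-digits true  as ended rewrite ended refl = refl
admissible-digits false as ended = refl

ended-digits : ∀ as → isSep (digits as) ≡ true → List.drop 1 as ≡ []
ended-digits [] eq = refl

valueOf-digits : ∀ as → valueOf as ≡ weight (digit (digits as)) + 2 * valueOf (List.drop 1 as)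
valueOf-digits []       = refl
valueOf-digits (a ∷ as) = refl

push-digits : ∀ as u → map bit (List.drop 1 as) ʳ++ push (written (digits as)) u ≡ map bit as ʳ++ u
push-digits []       u = refl
push-digits (a ∷ as) u = refl

length-drop1 : ∀ (as : List Bool) {n} → length as ≤ suc n → length (List.drop 1 as) ≤ n
length-drop1 []       _         = z≤n
length-drop1 (a ∷ as) (s≤s le) = le

number-complete : ∀ c e e′ l s as bs x w σ → valueOf s ≡ valueOf as + valueOf bs + weight c →
    canonical l s ≡ true →
  (e ≡ true → as ≡ []) → (e′ ≡ true → bs ≡ []) → length as ≤ length s → length bs ≤ length s →
  number c e e′ l (map bit s ++ sep ∷ x) (numberCertificate s as bs ++ w) σ ≡
  blocks x w ((sep ∷ (map bit as ʳ++ proj₁ (proj₁ σ)) , proj₂ (proj₁ σ)) ,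
              (sep ∷ (map bit bs ʳ++ proj₁ (proj₂ σ)) , proj₂ (proj₂ σ)))
number-complete false e e′ .true [] [] [] x w σ sum refl en en′ la lb = refl
number-complete true  e e′ l     [] [] [] x w σ ()  canon en en′ la lb
number-complete c e e′ l (s ∷ ss) as bs x w σ sum canon en en′ la lb
  -- Comparing parities forces the current bit of `k` to be the sum bit of this column. What remains
  -- after halving is the equation for the next columns, with the new carry.
  with refl , sum′ ← parity-unique s (digit (digits as) xor (digit (digits bs) xor c))
    {n = valueOf (List.drop 1 as) + valueOf (List.drop 1 bs) + weight
        (majority (digit (digits as)) (digit (digits bs)) c)}
    (trans sum (trans (cong₂ (λ m n → m + n + weight c) (valueOf-digits as) (valueOf-digits bs))
      (column (digit (digits as)) (digit (digits bs)) c (valueOf (List.drop 1 as))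
          (valueOf (List.drop 1 bs)))))
  rewrite admissible-digits e as en | admissible-digits e′ bs en′
        | agrees-refl s (digit (digits as)) (digit (digits bs)) c refl =
  trans (number-complete (majority (digit (digits as)) (digit (digits bs)) c) (isSep (digits as))
      (isSep (digits bs)) s
          ss (List.drop 1 as) (List.drop 1 bs) x w _ sum′ canon (ended-digits as) (ended-digits bs)
          (length-drop1 as la) (length-drop1 bs lb))
    (cong₂ (λ u v → blocks x w ((sep ∷ u , _) , (sep ∷ v , _))) (push-digits as _)
        (push-digits bs _))

pushWord : Bool → Word → Stacks → Stacks
pushWord false u ((y , c) , τ) = (u ʳ++ y , c) , τ
pushWord true  u (τ , (y , c)) = τ , (u ʳ++ y , c)

block-sound : ∀ d x w σ {τ} → block d x w σ ≡ just τ →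
  ∃[ u ] ∃[ x′ ] x ≡ map bit u ++ sep ∷ x′ × blocks x′ w
      (pushWord d (map bit u ++ [ sep ]) σ) ≡ just τ
block-sound false (bit b ∷ x) w σ eq with u , x′ , refl , eq′ ← block-sound false x w _ eq =
    b ∷ u , x′ , refl , eq′
block-sound true  (bit b ∷ x) w σ eq with u , x′ , refl , eq′ ← block-sound true x w _ eq =
    b ∷ u , x′ , refl , eq′
block-sound false (sep ∷ x)   w σ eq = [] , x , refl , eq
block-sound true  (sep ∷ x)   w σ eq = [] , x , refl , eq

block-complete : ∀ d u x w σ →
    block d (map bit u ++ sep ∷ x) w σ ≡ blocks x w (pushWord d (map bit u ++ [ sep ]) σ)
block-complete false []      x w σ = refl
block-complete true  []      x w σ = refl
block-complete false (b ∷ u) x w σ = block-complete false u x w _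
block-complete true  (b ∷ u) x w σ = block-complete true u x w _

mutual

  -- For soundness it suffices to follow the two instances. Whichever certificates end up on the
  -- other stacks, their acceptance witnesses that the instances are positive.
  tagged-sound : ∀ w σ {τ} → tagged w σ ≡ just τ →
      proj₁ (proj₁ τ) ≡ proj₁ (proj₁ σ) × proj₁ (proj₂ τ) ≡ proj₁ (proj₂ σ)
  tagged-sound []          σ refl = refl , refl
  tagged-sound (bit d ∷ w) σ eq   = value-sound d w σ eq

  value-sound : ∀ d w σ {τ} → value d w σ ≡ just τ →
      proj₁ (proj₁ τ) ≡ proj₁ (proj₁ σ) × proj₁ (proj₂ τ) ≡ proj₁ (proj₂ σ)
  value-sound false (a ∷ w) σ eq = tagged-sound w _ eq
  value-sound true  (a ∷ w) σ eq = tagged-sound w _ eq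

blockWord-ʳ++ : ∀ u us y → blockWord us ʳ++ ((map bit u ++ [ sep ]) ʳ++ y) ≡ blockWord
    (u ∷ us) ʳ++ y
blockWord-ʳ++ u us y =
    trans (sym (++-ʳ++ (map bit u ++ [ sep ])))
        (cong (_ʳ++ y) (++-assoc (map bit u) [ sep ] (blockWord us)))

record BlocksParsed (x : Word) (σ τ : Stacks) : Set where
  constructor blocksParsed
  field
    ws us vs     : List (List Bool)
    input≡       : x ≡ blockWord ws
    interleaving : Interleaving us vs ws
    left≡        : proj₁ (proj₁ τ) ≡ blockWord us ʳ++ proj₁ (proj₁ σ)
    right≡       : proj₁ (proj₂ τ) ≡ blockWord vs ʳ++ proj₁ (proj₂ σ)

blocks-sound : ∀ x w σ {τ} → blocks x w σ ≡ just τ → BlocksParsed x σ τ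
-- `block-sound` yields the remaining word as a component of its result, where structural descent is
-- lost; the length of the word serves as fuel instead.
blocks-sound x = go (length x) x ≤-refl
  where
  shorter-rest : ∀ u {x : Word} {n} → length (map bit u ++ sep ∷ x) ≤ suc n → length x ≤ n
  shorter-rest []      (s≤s le) = le
  shorter-rest (_ ∷ u) (s≤s le) =
      ≤-trans (n≤1+n _) (≤-trans
          (≤-trans (m≤n+m _ (length (map bit u))) (≤-reflexive (sym (length-++ (map bit u))))) le)

  go : ∀ n x → length x ≤ n → ∀ w σ {τ} → blocks x w σ ≡ just τ → BlocksParsed x σ τ
  go n       []      le w σ eq with eˡ , eʳ ← tagged-sound w σ eq =
      blocksParsed [] [] [] refl [] eˡ eʳ
  go (suc n) (a ∷ x) le (bit false ∷ w) σ eq with block-sound false (a ∷ x) w σ eq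
  ... | u , x′ , in≡ , eq′ with blocksParsed ws us vs refl i eˡ eʳ
      ← go n x′ (shorter-rest u (subst (λ y → length y ≤ suc n) in≡ le)) w _ eq′ =
    blocksParsed (u ∷ ws) (u ∷ us) vs in≡ (consˡ i) (trans eˡ (blockWord-ʳ++ u us _)) eʳ
  go (suc n) (a ∷ x) le (bit true ∷ w) σ eq with block-sound true (a ∷ x) w σ eq
  ... | u , x′ , in≡ , eq′ with blocksParsed ws us vs refl i eˡ eʳ
      ← go n x′ (shorter-rest u (subst (λ y → length y ≤ suc n) in≡ le)) w _ eq′ =
    blocksParsed (u ∷ ws) us (u ∷ vs) in≡ (consʳ i) eˡ (trans eʳ (blockWord-ʳ++ u vs _))

labels : ∀ {us vs ws : List (List Bool)} → Interleaving us vs ws → Word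
labels []        = []
labels (consˡ i) = bit false ∷ labels i
labels (consʳ i) = bit true ∷ labels i

length-labels : ∀ {us vs ws} (i : Interleaving us vs ws) → length (labels i) ≡ length ws
length-labels []        = refl
length-labels (consˡ i) = cong suc (length-labels i)
length-labels (consʳ i) = cong suc (length-labels i)

blocks-∷ : ∀ u x d w σ → blocks (map bit u ++ sep ∷ x) (bit d ∷ w) σ ≡ block d
    (map bit u ++ sep ∷ x) w σ
blocks-∷ []      x d w σ = refl
blocks-∷ (_ ∷ _) x d w σ = refl

blocks-complete : ∀ {us vs ws} (i : Interleaving us vs ws) w σ →
    blocks (blockWord ws) (labels i ++ w) σ ≡
  tagged w ((blockWord us ʳ++ proj₁ (proj₁ σ) , proj₂ (proj₁ σ)) ,
      (blockWord vs ʳ++ proj₁ (proj₂ σ) , proj₂ (proj₂ σ)))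
blocks-complete [] w σ = refl
blocks-complete {u ∷ us} {ws = u ∷ ws} (consˡ i) w σ = trans (blocks-∷ u (blockWord ws) false _ σ)
  (trans (block-complete false u (blockWord ws) _ σ) (trans (blocks-complete i w _)
    (cong (λ y → tagged w ((y , _) , _)) (blockWord-ʳ++ u us _))))
blocks-complete {us} {u ∷ vs} {u ∷ ws} (consʳ i) w σ = trans (blocks-∷ u (blockWord ws) true _ σ)
  (trans (block-complete true u (blockWord ws) _ σ) (trans (blocks-complete i w _)
    (cong (λ y → tagged w (_ , (y , _))) (blockWord-ʳ++ u vs _))))

tag : Bool → Word → Word
tag d []      = []
tag d (a ∷ c) = bit d ∷ a ∷ tag d c

length-tag : ∀ d c → length (tag d c) ≡ 2 * length c
length-tag d []      = refl
length-tag d (a ∷ c) = trans (cong (2 +_) (length-tag d c)) (sym (*-suc 2 (length c)))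

tagged-left : ∀ c w σ → tagged (tag false c ++ w) σ ≡
  tagged w ((proj₁ (proj₁ σ) , c ʳ++ proj₂ (proj₁ σ)) , proj₂ σ)
tagged-left []      w σ = refl
tagged-left (a ∷ c) w σ = tagged-left c w _

tagged-right : ∀ c w σ → tagged (tag true c ++ w) σ ≡
  tagged w (proj₁ σ , (proj₁ (proj₂ σ) , c ʳ++ proj₂ (proj₂ σ)))
tagged-right []      w σ = refl
tagged-right (a ∷ c) w σ = tagged-right c w _

-- Canonicity is recorded for `s` only, as the given verifier never sees `k` itself. For `as` and
-- `bs`, and for the blocks being codes, its acceptance of the two sides provides what is missing.
-- The reversals come from the stacks.
record Decomposed (x u v : Word) : Set where
  constructor decomposed
  field
    s as bs      : List Bool
    ws us vs     : List (List Bool)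
    sum          : valueOf s ≡ valueOf as + valueOf bs
    canon        : canonical true s ≡ true
    interleaving : Interleaving us vs ws
    input≡       : x ≡ instanceWord s ws
    left≡        : u ≡ reverse (instanceWord as us)
    right≡       : v ≡ reverse (instanceWord bs vs)

parse-sound : ∀ x w {y c y′ c′} → parse x w ≡ just ((y , c) , (y′ , c′)) → Decomposed x y y′
parse-sound x w eq
  with numberParsed s as bs rest cert refl sum canon _ _ continued
      ← number-sound false false false true x w _ eq
  with blocksParsed ws us vs refl i eˡ eʳ ← blocks-sound rest cert _ continued =
  decomposed s as bs ws us vs (trans sum (+-identityʳ _)) canon i refl
    (trans eˡ (sym (++-ʳ++ (map bit as)))) (trans eʳ (sym (++-ʳ++ (map bit bs))))

certificate : ∀ (s as bs : List Bool) {us vs ws} → Interleaving us vs ws → Word → Word → Word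
certificate s as bs i c c′ = numberCertificate s as bs ++ labels i ++ tag false c ++ tag true c′

length-certificate : ∀ s as bs {us vs ws} (i : Interleaving us vs ws) c c′ →
  length (certificate s as bs i c c′) ≡ 2 * length s + (length ws + (2 * length c + 2 * length c′))
length-certificate s as bs {ws = ws} i c c′
  rewrite length-++ (numberCertificate s as bs) {labels i ++ tag false c ++ tag true c′}
        | length-++ (labels i) {tag false c ++ tag true c′}
        | length-++ (tag false c) {tag true c′}
        | length-numberCertificate s as bs | length-labels i | length-tag false c
            | length-tag true c′ = refl

parse-complete : ∀ s as bs {us vs ws} (i : Interleaving us vs ws) c c′ →
  valueOf s ≡ valueOf as + valueOf bs → canonical true s ≡ true → length as ≤ length s →
      length bs ≤ length s →
  parse (instanceWord s ws) (certificate s as bs i c c′) ≡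
  just ((reverse (instanceWord as us) , reverse c) , (reverse (instanceWord bs vs) , reverse c′))
parse-complete s as bs {us} {vs} {ws} i c c′ sum canon la lb =
  trans (number-complete false false false true s as bs (blockWord ws)
      (labels i ++ tag false c ++ tag true c′) _
          (trans sum (sym (+-identityʳ _))) canon (λ ()) (λ ()) la lb)
  (trans (blocks-complete i (tag false c ++ tag true c′) _)
  (trans (tagged-left c (tag true c′) _)
  (trans (cong (λ w → tagged w _) (sym (++-identityʳ (tag true c′))))
  (trans (tagged-right c′ [] _)
    (cong₂ (λ y y′ → just ((y , reverse c) , (y′ , reverse c′)))
      (sym (++-ʳ++ (map bit as))) (sym (++-ʳ++ (map bit bs))))))))

-- Independent and bipartite subcollections

all-left : ∀ {A : Set} (xs : List A) → Interleaving xs [] xs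
all-left []       = []
all-left (x ∷ xs) = consˡ (all-left xs)

append-right : ∀ {A : Set} {xs zs : List A} (ys : List A) → Interleaving xs [] zs →
    Interleaving xs ys (zs ++ ys)
append-right []       []        = []
append-right (y ∷ ys) []        = consʳ (append-right ys [])
append-right ys       (consˡ i) = consˡ (append-right ys i)

⊆-++⁻ : ∀ {A : Set} {xs : List A} ys {zs} → xs ⊆ ys ++ zs →
  ∃[ us ] ∃[ vs ] xs ≡ us ++ vs × us ⊆ ys × vs ⊆ zs
⊆-++⁻ []       τ = [] , _ , refl , [] , τ
⊆-++⁻ (y ∷ ys) (.y ∷ʳ τ) with us , vs , eq , τ₁ , τ₂ ← ⊆-++⁻ ys τ = us , vs , eq , y ∷ʳ τ₁ , τ₂
⊆-++⁻ (y ∷ ys) (refl ∷ τ) with us , vs , eq , τ₁ , τ₂ ← ⊆-++⁻ ys τ =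
  y ∷ us , vs , cong (y ∷_) eq , refl ∷ τ₁ , τ₂

module _ {A : Set} where

  interleaving-⊆ : ∀ {as bs cs ds : List A} → Interleaving as bs cs → cs ⊆ ds →
    ∃[ as′ ] ∃[ bs′ ] Interleaving as′ bs′ ds × as ⊆ as′ × bs ⊆ bs′
  interleaving-⊆ []        []         = [] , [] , [] , [] , []
  -- Objects outside the subcollection may go to either part, here to the left one: a part only has
  -- to contain its colour class.
  interleaving-⊆ i         (d ∷ʳ τ) with as′ , bs′ , i′ , τ₁ , τ₂ ← interleaving-⊆ i τ =
    d ∷ as′ , bs′ , consˡ i′ , d ∷ʳ τ₁ , τ₂
  interleaving-⊆ (consˡ i) (refl ∷ τ) with as′ , bs′ , i′ , τ₁ , τ₂ ← interleaving-⊆ i τ =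
    _ , _ , consˡ i′ , refl ∷ τ₁ , τ₂
  interleaving-⊆ (consʳ i) (refl ∷ τ) with as′ , bs′ , i′ , τ₁ , τ₂ ← interleaving-⊆ i τ =
    _ , _ , consʳ i′ , τ₁ , refl ∷ τ₂

  ⊆-interleaving : ∀ {as bs cs ds es : List A} → as ⊆ cs → bs ⊆ ds → Interleaving cs ds es →
    ∃[ fs ] Interleaving as bs fs × fs ⊆ es
  ⊆-interleaving [] [] [] = [] , [] , []
  ⊆-interleaving (c ∷ʳ τ) τ′ (consˡ i) with fs , j , ρ ← ⊆-interleaving τ τ′ i = fs , j , c ∷ʳ ρ
  ⊆-interleaving (refl ∷ τ) τ′ (consˡ i) with fs , j , ρ ← ⊆-interleaving τ τ′ i =
      _ , consˡ j , refl ∷ ρ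
  ⊆-interleaving τ (d ∷ʳ τ′) (consʳ i) with fs , j , ρ ← ⊆-interleaving τ τ′ i = fs , j , d ∷ʳ ρ
  ⊆-interleaving τ (refl ∷ τ′) (consʳ i) with fs , j , ρ ← ⊆-interleaving τ τ′ i =
      _ , consʳ j , refl ∷ ρ

  interleaving-⊆ˡ : ∀ {as bs cs : List A} → Interleaving as bs cs → as ⊆ cs
  interleaving-⊆ˡ []        = []
  interleaving-⊆ˡ (consˡ i) = refl ∷ interleaving-⊆ˡ i
  interleaving-⊆ˡ (consʳ i) = _ ∷ʳ interleaving-⊆ˡ i

  interleaving-⊆ʳ : ∀ {as bs cs : List A} → Interleaving as bs cs → bs ⊆ cs
  interleaving-⊆ʳ []        = []
  interleaving-⊆ʳ (consˡ i) = _ ∷ʳ interleaving-⊆ʳ i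
  interleaving-⊆ʳ (consʳ i) = refl ∷ interleaving-⊆ʳ i

  sideOf : ∀ {as bs cs : List A} → Interleaving as bs cs → Fin (length cs) → Bool
  sideOf (consˡ i) zero    = false
  sideOf (consˡ i) (suc j) = sideOf i j
  sideOf (consʳ i) zero    = true
  sideOf (consʳ i) (suc j) = sideOf i j

  lookup-left : ∀ {P : A → Set} {as bs cs} (i : Interleaving as bs cs) j → sideOf i j ≡ false →
      All P as → P (lookup cs j)
  lookup-left (consˡ i) zero    eq (p ∷ ps) = p
  lookup-left (consˡ i) (suc j) eq (p ∷ ps) = lookup-left i j eq ps
  lookup-left (consʳ i) (suc j) eq ps       = lookup-left i j eq ps

  lookup-right : ∀ {P : A → Set} {as bs cs} (i : Interleaving as bs cs) j → sideOf i j ≡ true →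
      All P bs → P (lookup cs j)
  lookup-right (consʳ i) zero    eq (p ∷ ps) = p
  lookup-right (consʳ i) (suc j) eq (p ∷ ps) = lookup-right i j eq ps
  lookup-right (consˡ i) (suc j) eq ps       = lookup-right i j eq ps

  colour : (cs : List A) → (Fin (length cs) → Bool) → List A × List A
  colour []       side = [] , []
  colour (c ∷ cs) side with side zero | colour cs (side ∘ suc)
  ... | false | as , bs = c ∷ as , bs
  ... | true  | as , bs = as , c ∷ bs

  colour-interleaving : ∀ cs side →
      Interleaving (proj₁ (colour cs side)) (proj₂ (colour cs side)) cs
  colour-interleaving []       side = []
  colour-interleaving (c ∷ cs) side with side zero | colour-interleaving cs (side ∘ suc)
  ... | false | i = consˡ i
  ... | true  | i = consʳ i

  colour-left : ∀ {P : A → Set} cs side → (∀ j → side j ≡ false → P (lookup cs j)) →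
      All P (proj₁ (colour cs side))
  colour-left []       side p = []
  colour-left (c ∷ cs) side p with side zero in eq
  ... | false = p zero eq ∷ colour-left cs (side ∘ suc) (p ∘ suc)
  ... | true  = colour-left cs (side ∘ suc) (p ∘ suc)

  colour-right : ∀ {P : A → Set} cs side → (∀ j → side j ≡ true → P (lookup cs j)) →
      All P (proj₂ (colour cs side))
  colour-right []       side p = []
  colour-right (c ∷ cs) side p with side zero in eq
  ... | true  = p zero eq ∷ colour-right cs (side ∘ suc) (p ∘ suc)
  ... | false = colour-right cs (side ∘ suc) (p ∘ suc)

module _ (K : GeometricClass) where
  open GeometricClass K

  Disjoint : Object → Object → Set
  Disjoint o o′ = ¬ (region o ≬ region o′)

  disjoint-sym : ∀ {o o′} → Disjoint o o′ → Disjoint o′ o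
  disjoint-sym d (p , p∈o′ , p∈o) = d (p , p∈o , p∈o′)

  disjoint-irrefl : ∀ {o} → ¬ Disjoint o o
  disjoint-irrefl {o} d with p , p∈o ← nonempty o = d (p , p∈o , p∈o)

  -- Independent sets in a form without positions. Splitting by colours and merging the two copies
  -- both work on lists, where index sets would have to be transported along each operation.
  HasDisjointSublist : List Object × ℕ → Set
  HasDisjointSublist (os , k) = ∃[ os′ ] os′ ⊆ os × AllPairs Disjoint os′ × k ≤ length os′

  select : (os : List Object) → Subset (length os) → List Object
  select []       []            = []
  select (o ∷ os) (inside ∷ S)  = o ∷ select os S
  select (o ∷ os) (outside ∷ S) = select os S

  select-⊆ : ∀ os S → select os S ⊆ os
  select-⊆ []       []            = []
  select-⊆ (o ∷ os) (inside ∷ S)  = refl ∷ select-⊆ os S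
  select-⊆ (o ∷ os) (outside ∷ S) = o ∷ʳ select-⊆ os S

  length-select : ∀ os S → length (select os S) ≡ Subset.∣ S ∣
  length-select []       []            = refl
  length-select (o ∷ os) (inside ∷ S)  = cong suc (length-select os S)
  length-select (o ∷ os) (outside ∷ S) = length-select os S

  select-all : ∀ {P : Object → Set} os S → (∀ j → j Subset.∈ S → P (lookup os j)) →
      All P (select os S)
  select-all []       []            p = []
  select-all (o ∷ os) (inside ∷ S)  p = p zero here ∷ select-all os S (λ j → p (suc j) ∘ there)
  select-all (o ∷ os) (outside ∷ S) p = select-all os S (λ j → p (suc j) ∘ there)

  independent-tail : ∀ o os b S → Independent (intersectionGraph K (o ∷ os)) (b ∷ S) →
    Independent (intersectionGraph K os) S
  independent-tail o os b S ind i∈S j∈S (i≢j , meet) =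
      ind (there i∈S) (there j∈S) (i≢j ∘ Finₚ.suc-injective , meet)

  independent⇒disjoint : ∀ os S → Independent (intersectionGraph K os) S →
      AllPairs Disjoint (select os S)
  independent⇒disjoint []       []            ind = []
  independent⇒disjoint (o ∷ os) (inside ∷ S)  ind =
    select-all os S (λ j j∈S meet → ind here (there j∈S) ((λ ()) , meet)) ∷
    independent⇒disjoint os S (independent-tail o os inside S ind)
  independent⇒disjoint (o ∷ os) (outside ∷ S) ind =
    independent⇒disjoint os S (independent-tail o os outside S ind)

  positions : ∀ {os′ os : List Object} → os′ ⊆ os → Subset (length os)
  positions []         = []
  positions (_ ∷ʳ τ)   = outside ∷ positions τ
  positions (refl ∷ τ) = inside ∷ positions τ

  length-positions : ∀ {os′ os} (τ : os′ ⊆ os) → length os′ ≡ Subset.∣ positions τ ∣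
  length-positions []         = refl
  length-positions (_ ∷ʳ τ)   = length-positions τ
  length-positions (refl ∷ τ) = cong suc (length-positions τ)

  lookup-positions : ∀ {P : Object → Set} {os′ os} (τ : os′ ⊆ os) {j} → j Subset.∈ positions τ →
      All P os′ → P (lookup os j)
  lookup-positions (_ ∷ʳ τ)   (there j∈) ps       = lookup-positions τ j∈ ps
  lookup-positions (refl ∷ τ) here       (p ∷ _)  = p
  lookup-positions (refl ∷ τ) (there j∈) (_ ∷ ps) = lookup-positions τ j∈ ps

  disjoint⇒independent : ∀ {os′ os} (τ : os′ ⊆ os) → AllPairs Disjoint os′ →
    Independent (intersectionGraph K os) (positions τ)
  disjoint⇒independent (_ ∷ʳ τ)   d       (there i∈) (there j∈) (i≢j , meet) =
    disjoint⇒independent τ d i∈ j∈ (i≢j ∘ cong suc , meet)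
  disjoint⇒independent (refl ∷ τ) d       here       here       (i≢j , meet) = i≢j refl
  disjoint⇒independent (refl ∷ τ) (p ∷ d) here       (there j∈) (i≢j , meet) =
      lookup-positions τ j∈ p meet
  disjoint⇒independent (refl ∷ τ) (p ∷ d) (there i∈) here       (i≢j , meet) =
    disjoint-sym (lookup-positions τ i∈ p) meet
  disjoint⇒independent (refl ∷ τ) (p ∷ d) (there i∈) (there j∈) (i≢j , meet) =
    disjoint⇒independent τ d i∈ j∈ (i≢j ∘ cong suc , meet)

  toSublist : ∀ I → HasIndependentSet K I → HasDisjointSublist I
  toSublist (os , k) (S , ind , k≤) = select os S , select-⊆ os S , independent⇒disjoint os S ind ,
    subst (k ≤_) (sym (length-select os S)) k≤

  fromSublist : ∀ I → HasDisjointSublist I → HasIndependentSet K I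
  fromSublist (os , k) (os′ , τ , d , k≤) = positions τ , disjoint⇒independent τ d ,
    subst (k ≤_) (length-positions τ) k≤

  record Bisected (I : List Object × ℕ) : Set where
    field
      osˡ osʳ      : List Object
      kˡ kʳ        : ℕ
      interleaving : Interleaving osˡ osʳ (proj₁ I)
      total        : kˡ + kʳ ≡ proj₂ I
      independentˡ : HasIndependentSet K (osˡ , kˡ)
      independentʳ : HasIndependentSet K (osʳ , kʳ)

  colour-disjoint : ∀ os (side : Fin (length os) → Bool) →
    (∀ {i j} → Graph.Adjacent (intersectionGraph K os) i j → side i ≢ side j) →
    AllPairs Disjoint (proj₁ (colour os side)) × AllPairs Disjoint (proj₂ (colour os side))
  colour-disjoint []       side proper = [] , []
  colour-disjoint (o ∷ os) side proper
    with side zero in eq | colour-disjoint os (side ∘ suc)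
        (λ { (i≢j , meet) → proper (i≢j ∘ Finₚ.suc-injective , meet) })
  ... | false | d , d′ =
      (colour-left os (side ∘ suc) λ j eq′ meet → proper ((λ ()) , meet) (trans eq (sym eq′))) ∷ d ,
          d′
  ... | true  | d , d′ =
      d , (colour-right os (side ∘ suc) λ j eq′ meet →
          proper ((λ ()) , meet) (trans eq (sym eq′))) ∷ d′

  distribute : ∀ {k} a b → k ≤ a + b → ∃[ i ] ∃[ j ] i + j ≡ k × i ≤ a × j ≤ b
  distribute {k} a b k≤a+b with ≤-total k a
  ... | inj₁ k≤a = k , 0 , +-identityʳ k , k≤a , z≤n
  ... | inj₂ a≤k = a , k ∸ a , m+[n∸m]≡n a≤k , ≤-refl ,
    subst (k ∸ a ≤_) (m+n∸m≡n a b) (∸-monoˡ-≤ a k≤a+b)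

  bisect : ∀ I → HasBipartiteSubcollection K I → Bisected I
  bisect (os , k) (os′ , τ , k≤ , side , proper)
    with d , d′ ← colour-disjoint os′ side proper
       | i ← colour-interleaving os′ side
    with as , bs , i′ , τ₁ , τ₂ ← interleaving-⊆ i τ
       | kˡ , kʳ , total , kˡ≤ , kʳ≤ ← distribute (length (proj₁ (colour os′ side))) _
           (subst (k ≤_) (interleave-length i) k≤) = record
    { osˡ          = as
    ; osʳ          = bs
    ; kˡ           = kˡ
    ; kʳ           = kʳ
    ; interleaving = i′
    ; total        = total
    ; independentˡ = fromSublist (as , kˡ) (_ , τ₁ , d , kˡ≤)
    ; independentʳ = fromSublist (bs , kʳ) (_ , τ₂ , d′ , kʳ≤)
    }

  sideOf-proper : ∀ {as bs os} (i : Interleaving as bs os) → AllPairs Disjoint as →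
      AllPairs Disjoint bs →
    ∀ {m n} → Graph.Adjacent (intersectionGraph K os) m n → sideOf i m ≢ sideOf i n
  sideOf-proper (consˡ i) d       d′       {zero}  {zero}  (m≢n , meet) eq = m≢n refl
  sideOf-proper (consˡ i) (p ∷ d) d′       {zero}  {suc n} (m≢n , meet) eq =
      lookup-left i n (sym eq) p meet
  sideOf-proper (consˡ i) (p ∷ d) d′       {suc m} {zero}  (m≢n , meet) eq =
      disjoint-sym (lookup-left i m eq p) meet
  sideOf-proper (consˡ i) (p ∷ d) d′       {suc m} {suc n} (m≢n , meet) eq =
      sideOf-proper i d d′ (m≢n ∘ cong suc , meet) eq
  sideOf-proper (consʳ i) d       d′       {zero}  {zero}  (m≢n , meet) eq = m≢n refl
  sideOf-proper (consʳ i) d       (p ∷ d′) {zero}  {suc n} (m≢n , meet) eq =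
      lookup-right i n (sym eq) p meet
  sideOf-proper (consʳ i) d       (p ∷ d′) {suc m} {zero}  (m≢n , meet) eq =
      disjoint-sym (lookup-right i m eq p) meet
  sideOf-proper (consʳ i) d       (p ∷ d′) {suc m} {suc n} (m≢n , meet) eq =
      sideOf-proper i d d′ (m≢n ∘ cong suc , meet) eq

  unbisect : ∀ I → Bisected I → HasBipartiteSubcollection K I
  unbisect (os , k) b
    with as , τ , d , kˡ≤ ← toSublist _ (Bisected.independentˡ b)
       | bs , τ′ , d′ , kʳ≤ ← toSublist _ (Bisected.independentʳ b)
    with os′ , i , ρ ← ⊆-interleaving τ τ′ (Bisected.interleaving b) =
    os′ , ρ , subst₂ _≤_ (Bisected.total b) (sym (interleave-length i)) (+-mono-≤ kˡ≤ kʳ≤) ,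
    sideOf i , sideOf-proper i d d′

  -- Disjoint objects are distinct, so two sublists whose objects are
  -- disjoint from each other occupy different positions.
  merge : ∀ {as bs os} → as ⊆ os → bs ⊆ os → All (λ a → All (Disjoint a) bs) as →
    ∃[ cs ] cs ⊆ os × cs ↭ as ++ bs
  merge [] [] d = [] , [] , ↭-refl
  merge (o ∷ʳ τ) (.o ∷ʳ τ′) d with cs , ρ , π ← merge τ τ′ d = cs , o ∷ʳ ρ , π
  merge (refl ∷ τ) (o ∷ʳ τ′) (_ ∷ d) with cs , ρ , π ← merge τ τ′ d = o ∷ cs , refl ∷ ρ , prep o π
  merge {as} {o ∷ bs} (.o ∷ʳ τ) (refl ∷ τ′) d with cs , ρ , π ← merge τ τ′ (All.map All.tail d) =
    o ∷ cs , refl ∷ ρ , ↭-trans (prep o π) (↭-sym (shift o as bs))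
  merge (refl ∷ τ) (refl ∷ τ′) ((o∥o ∷ _) ∷ _) = ⊥-elim (disjoint-irrefl o∥o)

  double : ∀ os k → HasIndependentSet K (os , k) → HasBipartiteSubcollection K (os ++ os , k + k)
  double os k ind = unbisect _ record
    { osˡ          = os
    ; osʳ          = os
    ; kˡ           = k
    ; kʳ           = k
    ; interleaving = append-right os (all-left os)
    ; total        = refl
    ; independentˡ = ind
    ; independentʳ = ind
    }

  AllPairs-++⁻ : ∀ as {bs} → AllPairs Disjoint (as ++ bs) → All (λ a → All (Disjoint a) bs) as
  AllPairs-++⁻ []       d       = []
  AllPairs-++⁻ (a ∷ as) (p ∷ d) = ++⁻ʳ as p ∷ AllPairs-++⁻ as d

  fold : ∀ os {as} → as ⊆ os ++ os → AllPairs Disjoint as →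
    ∃[ cs ] cs ⊆ os × AllPairs Disjoint cs × length as ≤ length cs
  fold os τ d with us , vs , refl , τ₁ , τ₂ ← ⊆-++⁻ os τ
    with cs , ρ , π ← merge τ₁ τ₂ (AllPairs-++⁻ us d) =
    cs , ρ , AllPairs-resp-↭ (setoid Object) disjoint-sym ((λ { refl → id }) , (λ { refl → id }))
        (↭⇒↭ₛ (↭-sym π)) d ,
    ≤-reflexive (sym (↭-length π))

  halve-part : ∀ os {as k k′} → as ⊆ os ++ os → k ≤ k′ → HasIndependentSet K (as , k′) →
      HasIndependentSet K (os , k)
  halve-part os τ k≤k′ ind with bs , ρ , d , k′≤ ← toSublist _ ind
    with cs , ρ′ , d′ , bs≤cs ← fold os (⊆-trans ρ τ) d =
    fromSublist _ (cs , ρ′ , d′ , ≤-trans k≤k′ (≤-trans k′≤ bs≤cs))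

  halve : ∀ os k → HasBipartiteSubcollection K (os ++ os , k + k) → HasIndependentSet K (os , k)
  halve os k bip = halve-bisected (bisect _ bip)
    where
    halve-bisected : Bisected (os ++ os , k + k) → HasIndependentSet K (os , k)
    halve-bisected b with ≤-total k (Bisected.kˡ b)
    ... | inj₁ k≤kˡ = halve-part os (interleaving-⊆ˡ (Bisected.interleaving b)) k≤kˡ
        (Bisected.independentˡ b)
    ... | inj₂ kˡ≤k = halve-part os (interleaving-⊆ʳ (Bisected.interleaving b)) k≤kʳ
        (Bisected.independentʳ b)
      where
      k≤kʳ : k ≤ Bisected.kʳ b
      k≤kʳ = +-cancelˡ-≤ k _ _ (≤-trans (≤-reflexive (sym (Bisected.total b))) (+-monoˡ-≤ _ kˡ≤k))

-- The verifier

⟦⟧-mono : ∀ p {m n} → m ≤ n → ⟦ p ⟧ m ≤ ⟦ p ⟧ n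
⟦⟧-mono (con a)  m≤n = ≤-refl
⟦⟧-mono var      m≤n = m≤n
⟦⟧-mono (p :+ q) m≤n = +-mono-≤ (⟦⟧-mono p m≤n) (⟦⟧-mono q m≤n)
⟦⟧-mono (p :* q) m≤n = *-mono-≤ (⟦⟧-mono p m≤n) (⟦⟧-mono q m≤n)

-- Nothing is pushed on a stack pair without a symbol being read. So each side is no longer than
-- instance and certificate together, which turns the time of `check`, measured on the side, into a
-- polynomial in the length of the input.
record Fits (n : ℕ) (σ : Stacks) : Set where
  constructor _,_
  field
    fitsˡ : length (proj₁ (proj₁ σ)) + length (proj₂ (proj₁ σ)) ≤ n
    fitsʳ : length (proj₁ (proj₂ σ)) + length (proj₂ (proj₂ σ)) ≤ n

fits-none : ∀ {n σ} → Fits n σ → Fits (suc n) σ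
fits-none (l , r) = m≤n⇒m≤1+n l , m≤n⇒m≤1+n r

private
  more : ∀ {n} (y c : Word) → length y + length c ≤ n → length y + suc (length c) ≤ suc n
  more y c le = ≤-trans (≤-reflexive (+-suc (length y) (length c))) (s≤s le)

fits-leftDigit : ∀ a {n σ} → Fits n σ → Fits (suc n) (pushAll (leftDigit a) σ)
fits-leftDigit (bit _) (l , r) = s≤s l , m≤n⇒m≤1+n r
fits-leftDigit sep     (l , r) = m≤n⇒m≤1+n l , m≤n⇒m≤1+n r

fits-rightDigit : ∀ a {n σ} → Fits n σ → Fits (suc n) (pushAll (rightDigit a) σ)
fits-rightDigit (bit _) (l , r) = m≤n⇒m≤1+n l , s≤s r
fits-rightDigit sep     (l , r) = m≤n⇒m≤1+n l , m≤n⇒m≤1+n r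

fits-toY : ∀ d a {n σ} → Fits n σ → Fits (suc n) (pushAll (toY d a) σ)
fits-toY false a (l , r) = s≤s l , m≤n⇒m≤1+n r
fits-toY true  a (l , r) = m≤n⇒m≤1+n l , s≤s r

fits-toC : ∀ d a {n σ} → Fits n σ → Fits (suc n) (pushAll (toC d a) σ)
fits-toC false a {σ = (y , c) , _} (l , r) = more y c l , m≤n⇒m≤1+n r
fits-toC true  a {σ = _ , (y , c)} (l , r) = m≤n⇒m≤1+n l , more y c r

module _ {N : ℕ} {τ : Stacks} where

  private
    skipX : ∀ {n k} → n + suc k ≤ N → suc n + k ≤ N
    skipX {n} le = ≤-trans (≤-reflexive (sym (+-suc n _))) le

    skipW : ∀ {n} x {w} → n + (x + suc w) ≤ N → suc n + (x + w) ≤ N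
    skipW {n} x le = ≤-trans (≤-reflexive (trans (sym (+-suc n _)) (cong (n +_) (sym (+-suc x _)))))
        le

  mutual

    number-fits : ∀ c e e′ l x w σ {n} → n + (length x + length w) ≤ N → Fits n σ →
      number c e e′ l x w σ ≡ just τ → Fits N τ
    number-fits false e e′ true (sep ∷ x) w σ le (l , r) eq =
      blocks-fits x w _ (skipX le) (s≤s l , s≤s r) eq
    number-fits c e e′ l (bit s ∷ x) (a ∷ w) σ le f eq =
      number′-fits c _ e′ (digit a) (bit s ∷ x) w _ (skipW (length (bit s ∷ x)) le)
          (fits-leftDigit a f)
        (proj₂ (if-just (admissible e a) eq))

    number′-fits : ∀ c e e′ a x w σ {n} → n + (length x + length w) ≤ N → Fits n σ →
      number′ c e e′ a x w σ ≡ just τ → Fits N τ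
    number′-fits c e e′ a (bit s ∷ x) (b ∷ w) σ {n} le f eq =
      -- Two symbols are consumed here, but at most one is pushed, so that only one of them is
      -- counted.
      number-fits _ e _ s x w _ (≤-trans (n≤1+n _) (skipW {suc n} (length x) (skipX le)))
          (fits-rightDigit b f)
        (proj₂ (if-just (admissible e′ b ∧ agrees s a (digit b) c) eq))

    blocks-fits : ∀ x w σ {n} → n + (length x + length w) ≤ N → Fits n σ → blocks x w σ ≡ just τ →
        Fits N τ
    blocks-fits []      w           σ le f eq = tagged-fits w σ le f eq
    blocks-fits (a ∷ x) (bit d ∷ w) σ le f eq =
      block-fits d (a ∷ x) w σ (skipW (length (a ∷ x)) le) (fits-none f) eq

    block-fits : ∀ d x w σ {n} → n + (length x + length w) ≤ N → Fits n σ → block d x w σ ≡ just τ →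
        Fits N τ
    block-fits d (bit b ∷ x) w σ le f eq = block-fits d x w _ (skipX le) (fits-toY d (bit b) f) eq
    block-fits d (sep ∷ x)   w σ le f eq = blocks-fits x w _ (skipX le) (fits-toY d sep f) eq

    tagged-fits : ∀ w σ {n} → n + length w ≤ N → Fits n σ → tagged w σ ≡ just τ → Fits N τ
    tagged-fits []          σ {n} le (l , r) refl =
        ≤-trans l (≤-trans (m≤m+n n 0) le) , ≤-trans r (≤-trans (m≤m+n n 0) le)
    tagged-fits (bit d ∷ w) σ {n} le f eq = value-fits d w σ (skipX le) (fits-none f) eq

    value-fits : ∀ d w σ {n} → n + length w ≤ N → Fits n σ → value d w σ ≡ just τ → Fits N τ
    value-fits d (a ∷ w) σ le f eq = tagged-fits w _ (skipX le) (fits-toC d a f) eq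

  parse-fits : ∀ x w → length x + length w ≤ N → parse x w ≡ just τ → Fits N τ
  parse-fits x w le eq = number-fits false false false true x w _ {0} le (z≤n , z≤n) eq

module Verify (M : TuringMachine) (time bound : Polynomial) where
  open TuringMachine M using (workSymbols; Halted)
  open Programs workSymbols
  open Clocks workSymbols
  open Check M time bound
  open Parser M time bound

  second first : Bool → Program Whole Bool
  second false = return false
  second true  = on (sndL ⨾ sndL) check
  first false = return false
  first true  = bind bool-finite (on (sndL ⨾ fstL) check) second

  verify : Program Whole Bool
  verify = bind bool-finite parseProgram first

  verdict : Maybe Stacks → Bool
  verdict nothing                        = false
  verdict (just ((y , c) , (y′ , c′))) =
      accepts (reverse y) (reverse c) ∧ accepts (reverse y′) (reverse c′)

  checkTimeₚ verifyTime : Polynomial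
  checkTimeₚ = ((con 1 :+ ((con 1 :+ var) :* con 3)) :+ timesTime bound (con 3)) :+
      (con 1 :+ (con 1 :+ time))
  verifyTime = (con 2 :+ var) :+ (checkTimeₚ :+ checkTimeₚ)

  checkTime-≤ : ∀ {m n N} → m + n ≤ N → checkTime m n ≤ ⟦ checkTimeₚ ⟧ N
  checkTime-≤ {m} {n} {N} le = +-mono-≤
    (+-mono-≤ (+-monoʳ-≤ 1 (*-monoˡ-≤ 3 (s≤s m≤N))) (⟦⟧-mono (timesTime bound (con 3)) m≤N))
    (s≤s (s≤s (⟦⟧-mono time le)))
    where
    m≤N : m ≤ N
    m≤N = ≤-trans (m≤m+n m n) le

  module _ (halts : ∀ y c → Halted (final y c)) where

    check-side : ∀ {N} y c → length y + length c ≤ N →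
      ⟨ check ⟩ (⟦ checkTimeₚ ⟧ N) (side (y , c)) (λ b _ → b ≡ accepts (reverse y) (reverse c))
    check-side y c le = ⟨⟩-mono (λ _ _ → id) (checkTime-≤ le)
      (check-spec halts y c _ (fill-clocked bound {u = y} {J = _≡ ready y c} refl))

    first-spec : ∀ {N} m → (∀ σ → m ≡ just σ → Fits N σ) → ∀ b ts → Parsed m b ts →
      ⟨ first b ⟩ (⟦ checkTimeₚ ⟧ N + ⟦ checkTimeₚ ⟧ N) ts (λ b′ _ → b′ ≡ verdict m)
    first-spec nothing fits false ts rejected = return-spec refl
    first-spec {N} (just ((y , c) , (y′ , c′))) fits true (t , _) parsed = bind-spec (on-spec
      (⟨⟩-mono (λ b ts eq → second-spec b (accepts (reverse y) (reverse c))
          (t , (ts , side (y′ , c′))) eq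
          (on-spec (⟨⟩-mono (λ b′ _ eq′ → cong₂ _∧_ refl eq′) ≤-refl
              (check-side y′ c′ (Fits.fitsʳ (fits _ refl))))))
        ≤-refl (check-side y c (Fits.fitsˡ (fits _ refl)))))
      where
      second-spec : ∀ b a ts → b ≡ a →
        ⟨ second true ⟩ (⟦ checkTimeₚ ⟧ N) ts
            (λ b′ _ → true ∧ b′ ≡ true ∧ accepts (reverse y′) (reverse c′)) →
        ⟨ second b ⟩ (⟦ checkTimeₚ ⟧ N) ts (λ b′ _ → b′ ≡ a ∧ accepts (reverse y′) (reverse c′))
      second-spec false a ts refl r = return-spec refl
      second-spec true  a ts refl r = r

    verify-spec : ∀ x w → ⟨ verify ⟩ (⟦ verifyTime ⟧ (length x + length w))
      ((loadTape x , loadTape w) , pureA (Side ⊗ Side) emptyTape) (λ b _ → b ≡ verdict (parse x w))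
    verify-spec x w = bind-spec
        (⟨⟩-mono (first-spec (parse x w) (λ σ → parse-fits x w ≤-refl)) ≤-refl (parse-spec x w))

-- Membership in NP

length-blockWord : ∀ {us vs ws} → Interleaving us vs ws →
  length (blockWord us) + length (blockWord vs) ≡ length (blockWord ws)
length-blockWord []        = refl
length-blockWord {u ∷ us} {vs} {u ∷ ws} (consˡ i)
  rewrite length-++ (map bit u) {sep ∷ blockWord us} | length-++ (map bit u) {sep ∷ blockWord ws} =
  trans (+-assoc (length (map bit u)) _ _)
      (cong (λ n → length (map bit u) + suc n) (length-blockWord i))
length-blockWord {us} {v ∷ vs} {v ∷ ws} (consʳ i)
  rewrite length-++ (map bit v) {sep ∷ blockWord vs} | length-++ (map bit v) {sep ∷ blockWord ws} =
  trans (sym (+-assoc (length (blockWord us)) (length (map bit v)) _))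
    (trans (cong (_+ suc (length (blockWord vs)))
        (+-comm (length (blockWord us)) (length (map bit v))))
      (trans (+-assoc (length (map bit v)) (length (blockWord us)) _)
        (cong (length (map bit v) +_) (trans (+-suc _ _) (cong suc (length-blockWord i))))))

length-instanceWord : ∀ bs us →
    length (instanceWord bs us) ≡ length bs + suc (length (blockWord us))
length-instanceWord bs us = trans (length-++ (map bit bs)) (cong (_+ _) (length-map bit bs))

length≤blockWord : ∀ us → length us ≤ length (blockWord us)
length≤blockWord []       = z≤n
length≤blockWord (u ∷ us) = ≤-trans (s≤s (length≤blockWord us))
  (≤-trans (m≤n+m _ (length (map bit u))) (≤-reflexive (sym (length-++ (map bit u)))))

module _ (K : GeometricClass) where
  open GeometricClass K

  instanceOf : List Object → ℕ → Word
  instanceOf os k = instanceWord (binary k) (map code os)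

  encode≡instance : ∀ os k → encode K (os , k) ≡ instanceOf os k
  encode≡instance os k = cong (λ w → map bit (binary k) ++ sep ∷ w) (blocks≡ os)
    where
    blocks≡ : ∀ os → concatMap (λ o → map bit (code o) ++ [ sep ]) os ≡ blockWord (map code os)
    blocks≡ []       = refl
    blocks≡ (o ∷ os) = trans (++-assoc (map bit (code o)) [ sep ] _)
        (cong (λ w → map bit (code o) ++ sep ∷ w) (blocks≡ os))

  map-interleaving⁺ : ∀ {as bs cs} → Interleaving as bs cs →
      Interleaving (map code as) (map code bs) (map code cs)
  map-interleaving⁺ []        = []
  map-interleaving⁺ (consˡ i) = consˡ (map-interleaving⁺ i)
  map-interleaving⁺ (consʳ i) = consʳ (map-interleaving⁺ i)

  map-interleaving⁻ : ∀ as bs {ws} →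
    Interleaving (map code as) (map code bs) ws →
    ∃[ cs ] ws ≡ map code cs × Interleaving as bs cs
  map-interleaving⁻ []       []       []        = [] , refl , []
  map-interleaving⁻ (a ∷ as) []       (consˡ i) with cs , refl , j ← map-interleaving⁻ as [] i =
      a ∷ cs , refl , consˡ j
  map-interleaving⁻ []       (b ∷ bs) (consʳ i) with cs , refl , j ← map-interleaving⁻ [] bs i =
      b ∷ cs , refl , consʳ j
  map-interleaving⁻ (a ∷ as) (b ∷ bs) (consˡ i) with cs , refl , j ← map-interleaving⁻ as
      (b ∷ bs) i = a ∷ cs , refl , consˡ j
  map-interleaving⁻ (a ∷ as) (b ∷ bs) (consʳ i) with cs , refl , j ← map-interleaving⁻
      (a ∷ as) bs i = b ∷ cs , refl , consʳ j

  module _ (inNP : InNP (MaximumIndependentSet K)) where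
    open InNP inNP
    open Verify verifier time certificateLength
    open Check verifier time certificateLength using (accepts)

    accepts-complete : ∀ os k → HasIndependentSet K (os , k) →
      ∃[ c ] length c ≤ ⟦ certificateLength ⟧ (length (instanceOf os k)) × accepts
          (instanceOf os k) c ≡ true
    accepts-complete os k ind
      with c , c≤ , acc ← Equivalence.to (correct (instanceOf os k))
          ((os , k) , encode≡instance os k , ind) =
      c , c≤ , cong₂ _∧_ (Equivalence.to T-≡ (≤⇒≤ᵇ c≤)) acc

    -- `correct` speaks about all words. Acceptance therefore shows that the word is an encoding,
    -- and comparing separators identifies `bs` and the blocks without any decoding by a machine.
    accepts-sound : ∀ bs us c → accepts (instanceWord bs us) c ≡ true →
      ∃[ os ] ∃[ k ] bs ≡ binary k × us ≡ map code os × HasIndependentSet K (os , k)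
    accepts-sound bs us c acc
      with (os , k) , enc≡ , ind ← Equivalence.from (correct (instanceWord bs us))
             (c , ≤ᵇ⇒≤ _ _ (Equivalence.from T-≡ (∧-conicalˡ _ _ acc)) , ∧-conicalʳ _ _ acc)
      with bs≡ , us≡ ← sep-injective bs (binary k) (trans (sym enc≡) (encode≡instance os k)) =
      os , k , bs≡ , blockWord-injective us (map code os) us≡ , ind

    -- Two symbols for each bit of `k`, one label for each object, and two symbols for each symbol
    -- of the two inner certificates. The latter are bounded at the length of the whole instance,
    -- since neither part is longer.
    certificateBound : Polynomial
    certificateBound = (con 2 :* var) :+
        (var :+ ((con 2 :* certificateLength) :+ (con 2 :* certificateLength)))

    verdict-complete : ∀ x → MaximumBipartiteSubgraph K x →
      ∃[ w ] length w ≤ ⟦ certificateBound ⟧ (length x) × verdict (parse x w) ≡ true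
    verdict-complete _ ((os , k) , refl , bip) rewrite encode≡instance os k
      with record { osˡ = osˡ ; osʳ = osʳ ; kˡ = kˡ ; kʳ = kʳ ; interleaving = i ; total = refl
                  ; independentˡ = indˡ ; independentʳ = indʳ } ← bisect K _ bip
      with cˡ , cˡ≤ , accˡ ← accepts-complete osˡ kˡ indˡ
         | cʳ , cʳ≤ , accʳ ← accepts-complete osʳ kʳ indʳ =
      certificate (binary k) (binary kˡ) (binary kʳ) j cˡ cʳ , bound ,
      trans (cong verdict (parse-complete (binary k) (binary kˡ) (binary kʳ) j cˡ cʳ sum
          (canonical-binary k) lenˡ lenʳ))
        (cong₂ _∧_ (trans (cong₂ accepts (reverse-involutive (instanceOf osˡ kˡ))
            (reverse-involutive cˡ)) accˡ)
                   (trans (cong₂ accepts (reverse-involutive (instanceOf osʳ kʳ))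
                       (reverse-involutive cʳ)) accʳ))
      where
      j = map-interleaving⁺ i

      sum : valueOf (binary k) ≡ valueOf (binary kˡ) + valueOf (binary kʳ)
      sum = trans (valueOf-binary k) (sym (cong₂ _+_ (valueOf-binary kˡ) (valueOf-binary kʳ)))

      lenˡ : length (binary kˡ) ≤ length (binary k)
      lenˡ = canonical-length (binary kˡ) (binary k) (canonical-binary kˡ)
          (subst (valueOf (binary kˡ) ≤_) (sym sum) (m≤m+n _ _))

      lenʳ : length (binary kʳ) ≤ length (binary k)
      lenʳ = canonical-length (binary kʳ) (binary k) (canonical-binary kʳ)
          (subst (valueOf (binary kʳ) ≤_) (sym sum) (m≤n+m _ _))

      n = length (instanceOf os k)

      instance≤ : ∀ {os′ k′} → length (binary k′) ≤ length (binary k) →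
        length (blockWord (map code os′)) ≤ length (blockWord (map code os)) →
            length (instanceOf os′ k′) ≤ n
      instance≤ {os′} {k′} le le′ =
          subst₂ _≤_ (sym (length-instanceWord (binary k′) (map code os′)))
        (sym (length-instanceWord (binary k) (map code os))) (+-mono-≤ le (s≤s le′))

      binary≤ : length (binary k) ≤ n
      binary≤ = subst (length (binary k) ≤_) (sym (length-instanceWord (binary k) (map code os)))
          (m≤m+n _ _)

      objects≤ : length (map code os) ≤ n
      objects≤ = subst (length (map code os) ≤_)
          (sym (length-instanceWord (binary k) (map code os)))
        (≤-trans (length≤blockWord (map code os)) (≤-trans (n≤1+n _) (m≤n+m _ _)))

      bound : length (certificate (binary k) (binary kˡ) (binary kʳ) j cˡ cʳ) ≤ ⟦ certificateBound ⟧
          n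
      bound = subst (_≤ ⟦ certificateBound ⟧ n)
          (sym (length-certificate (binary k) (binary kˡ) (binary kʳ) j cˡ cʳ))
        (+-mono-≤ (*-monoʳ-≤ 2 binary≤) (+-mono-≤ objects≤ (+-mono-≤
          (*-monoʳ-≤ 2 (≤-trans cˡ≤ (⟦⟧-mono certificateLength
            (instance≤ {osˡ} {kˡ} lenˡ
                (subst (length (blockWord (map code osˡ)) ≤_) (length-blockWord j) (m≤m+n _ _))))))
          (*-monoʳ-≤ 2 (≤-trans cʳ≤ (⟦⟧-mono certificateLength
            (instance≤ {osʳ} {kʳ} lenʳ
                (subst (length (blockWord (map code osʳ)) ≤_) (length-blockWord j)
                    (m≤n+m _ _)))))))))

    verdict-sound : ∀ x w → verdict (parse x w) ≡ true → MaximumBipartiteSubgraph K x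
    verdict-sound x w acc with parse x w in eq
    ... | just ((y , c) , (y′ , c′))
      with decomposed s as bs ws us vs sum canon i refl refl refl ← parse-sound x w eq
      with osˡ , kˡ , refl , refl , indˡ ← accepts-sound as us (reverse c)
             (subst (λ u → accepts u (reverse c) ≡ true) (reverse-involutive (instanceWord as us))
                 (∧-conicalˡ _ _ acc))
         | osʳ , kʳ , refl , refl , indʳ ← accepts-sound bs vs (reverse c′)
             (subst (λ u → accepts u (reverse c′) ≡ true) (reverse-involutive (instanceWord bs vs))
               (∧-conicalʳ (accepts (reverse (reverse (instanceWord as us))) (reverse c)) _ acc))
      -- Every block of the input went to one of the sides, and both sides consist of codes; hence
      -- the input consists of codes too.
      with os , refl , j ← map-interleaving⁻ osˡ osʳ i =
      (os , kˡ + kʳ) ,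
      trans (encode≡instance os (kˡ + kʳ)) (cong (λ b → instanceWord b (map code os))
        (trans (cong binary (trans (sym (cong₂ _+_ (valueOf-binary kˡ) (valueOf-binary kʳ)))
            (sym sum))) (binary-valueOf s canon))) ,
      unbisect K _ record
        { osˡ = osˡ ; osʳ = osʳ ; kˡ = kˡ ; kʳ = kʳ ; interleaving = j ; total = refl
        ; independentˡ = indˡ ; independentʳ = indʳ }

    bipartite-inNP : InNP (MaximumBipartiteSubgraph K)
    bipartite-inNP = record
      { verifier          = compile verify
      ; time              = verifyTime
      ; certificateLength = certificateBound
      ; halts             = λ x w → proj₁ (compiled x w)
      ; correct           = λ x → mk⇔
          (λ bip → let w , w≤ , acc = verdict-complete x bip in
            w , w≤ , trans (proj₁ (proj₂ (proj₂ (compiled x w)))) acc)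
          (λ { (w , _ , acc) → verdict-sound x w
              (trans (sym (proj₁ (proj₂ (proj₂ (compiled x w))))) acc) })
      }
      where
      compiled = λ x w → compile-spec verify x w (verify-spec halts x w)

-- The reduction

afterSep : Word → Word
afterSep []          = []
afterSep (sep ∷ x)   = x
afterSep (bit _ ∷ x) = afterSep x

prependZero : Word → Word
prependZero (bit b ∷ x) = bit false ∷ bit b ∷ x
prependZero x           = x

doubled : Word → Word
doubled x = prependZero (x ++ afterSep x)

afterSep-separated : ∀ u x → afterSep (map bit u ++ sep ∷ x) ≡ x
afterSep-separated []      x = refl
afterSep-separated (_ ∷ u) x = afterSep-separated u x

afterSep-unseparated : ∀ u → afterSep (map bit u) ≡ []
afterSep-unseparated []      = refl
afterSep-unseparated (_ ∷ u) = afterSep-unseparated u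

prependZero-twice : ∀ u x → prependZero (map bit u ++ sep ∷ x) ≡ map bit (twice u) ++ sep ∷ x
prependZero-twice []      x = refl
prependZero-twice (_ ∷ _) x = refl

doubled-separated : ∀ u x → doubled (map bit u ++ sep ∷ x) ≡ map bit (twice u) ++ sep ∷ (x ++ x)
doubled-separated u x rewrite afterSep-separated u x | ++-assoc (map bit u) (sep ∷ x) x =
    prependZero-twice u (x ++ x)

doubled-unseparated : ∀ u → doubled (map bit u) ≡ map bit (twice u)
doubled-unseparated u rewrite afterSep-unseparated u | ++-identityʳ (map bit u) = prependZero-bits u
  where
  prependZero-bits : ∀ u → prependZero (map bit u) ≡ map bit (twice u)
  prependZero-bits []      = refl
  prependZero-bits (_ ∷ _) = refl

module _ (K : GeometricClass) where
  open GeometricClass K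

  map-code-halve : ∀ os us vs → map code os ≡ us ++ vs →
      ∃[ as ] ∃[ bs ] os ≡ as ++ bs × map code as ≡ us × map code bs ≡ vs
  map-code-halve os       []       vs eq = [] , os , refl , refl , eq
  map-code-halve (o ∷ os) (u ∷ us) vs eq with as , bs , refl , refl , eq′ ← map-code-halve os us vs
      (∷-injectiveʳ eq) =
    o ∷ as , bs , refl , cong₂ _∷_ (∷-injectiveˡ eq) refl , eq′

  doubled-complete : ∀ x → MaximumIndependentSet K x → MaximumBipartiteSubgraph K (doubled x)
  doubled-complete _ ((os , k) , refl , ind) = (os ++ os , k + k) ,
    trans (encode≡instance K (os ++ os) (k + k)) (trans
      (cong₂ (λ u x → map bit u ++ sep ∷ x) (binary-double k)
        (trans (cong blockWord (map-++ code os os)) (blockWord-++ (map code os) (map code os))))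
      (trans (sym (doubled-separated (binary k) (blockWord (map code os))))
          (cong doubled (sym (encode≡instance K os k))))) ,
    double K os k ind

  -- That `x` is an encoding has to be deduced from its image alone. Without a separator in `x` the
  -- image has none either and encodes nothing; otherwise both the number and the list of blocks can
  -- be halved.
  doubled-sound : ∀ x → MaximumBipartiteSubgraph K (doubled x) → MaximumIndependentSet K x
  doubled-sound x ((os , n) , enc≡ , bip) with separate x
  ... | unseparated u = contradiction
    (trans (sym (doubled-unseparated u)) (trans (sym enc≡) (encode≡instance K os n)))
        (unseparated≢ (twice u) (binary n))
  ... | separated u y
    with u≡ , y≡ ← sep-injective (twice u) (binary n)
           (trans (sym (doubled-separated u y)) (trans (sym enc≡) (encode≡instance K os n)))
    with k , refl , refl ← binary-half u n u≡
       | vs , refl , os≡ ← blockWord-halve y (map code os) y≡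
    with as , bs , refl , as≡ , bs≡ ← map-code-halve os vs vs os≡
    -- So far only the code words of the two halves agree. Since a code determines its object, both
    -- halves are the same collection.
    with refl ← map-injective code-injective (trans as≡ (sym bs≡))
       | refl ← as≡ =
    (as , k) , encode≡instance K as k , halve K as k bip

-- A machine for the reduction

module Doubler (w : ℕ) where
  open Programs w
  open Clocks w
  open Transfer w

  Triple : Shape
  Triple = single ⊗ (single ⊗ single)

  -- The first stack receives the whole word and the second one what follows
  -- its first separator; writing them back from the right end of the word
  -- leaves the head at the left end of the result.
  copyStep : Bool → Cells Triple → (Bool ⊎ ⊤) × Actions Triple
  copyStep seen (input a , _) = inj₁ (seen ∨ isSep a) ,
    (input a , right) , (input a , right) , (if seen then (input a , right) else (blank , stay))
  copyStep seen (c , _)       = inj₂ tt , (c , left) , (blank , left) , (blank , left)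

  copy : Bool → Program Triple ⊤
  copy = loop bool-finite (λ seen → prim (copyStep seen))

  captured : Bool → Word → Word
  captured true  y = y
  captured false y = afterSep y

  after-left : ∀ (t : Tape w) → Tape.after (moveHead left t) ≡ Tape.head t ∷ Tape.after t
  after-left (tape []      a rs) = refl
  after-left (tape (_ ∷ _) a rs) = refl

  -- The result is written leftwards, starting at the head, so from here on the cells to the left
  -- are scratch space. What matters is that no input symbol follows directly on the right, where it
  -- would be read as part of the result.
  Copied : Word → Word → Tapes Triple → Set
  Copied u v (t , s₁ , s₂) =
      inputPrefix (Tape.after t) ≡ [] × s₁ ≡ popping (blank ∷ []) u × s₂ ≡ popping (blank ∷ []) v

  copied : ∀ ls c rs u v → inputPrefix (c ∷ rs) ≡ [] →
    Copied u v (perform Triple ((c , left) , (blank , left) , (blank , left))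
        (tape ls c rs , pushed u , pushed v))
  copied ls c rs u v eq =
      trans (cong inputPrefix (after-left (tape ls c rs))) eq , pushed-left u , pushed-left v

  copy-spec : ∀ cs seen ls u v →
      ⟨ copy seen ⟩ (suc (length (inputPrefix cs)) * 1) (at ls cs , pushed u , pushed v)
    (λ _ → Copied (inputPrefix cs ʳ++ u) (captured seen (inputPrefix cs) ʳ++ v))
  copy-spec [] false ls u v = loop-spec {m = 1} (prim-spec (copied ls blank [] u v refl))
  copy-spec [] true  ls u v = loop-spec {m = 1} (prim-spec (copied ls blank [] u v refl))
  copy-spec (blank ∷ cs) false ls u v = loop-spec {m = 1} (prim-spec (copied ls blank cs u v refl))
  copy-spec (blank ∷ cs) true  ls u v = loop-spec {m = 1} (prim-spec (copied ls blank cs u v refl))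
  copy-spec (work s ∷ cs) false ls u v =
      loop-spec {m = 1} (prim-spec (copied ls (work s) cs u v refl))
  copy-spec (work s ∷ cs) true  ls u v =
      loop-spec {m = 1} (prim-spec (copied ls (work s) cs u v refl))
  copy-spec (input (bit b) ∷ cs) false ls u v = loop-spec {m = 1} (prim-spec
    (subst (λ t → ⟨ copy false ⟩ _ (t , _) _) (sym (moveHead-right ls _ cs))
        (copy-spec cs false _ (bit b ∷ u) v)))
  copy-spec (input sep ∷ cs) false ls u v = loop-spec {m = 1} (prim-spec
    (subst (λ t → ⟨ copy true ⟩ _ (t , _) _) (sym (moveHead-right ls _ cs))
        (copy-spec cs true _ (sep ∷ u) v)))
  copy-spec (input a ∷ cs) true ls u v = loop-spec {m = 1} (prim-spec
    (subst (λ t → ⟨ copy true ⟩ _ (t , _) _) (sym (moveHead-right ls _ cs))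
        (copy-spec cs true _ (a ∷ u) (a ∷ v))))

  unstackStep : Bool → Cells (single ⊗ single) → (Bool ⊎ Bool) × Actions (single ⊗ single)
  unstackStep f (c , input a) = inj₁ (isSep a) , (input a , left) , (blank , left)
  unstackStep f (c , s)       = inj₂ f , (c , stay) , (s , stay)

  unstack : Bool → Program (single ⊗ single) Bool
  unstack = loop bool-finite (λ f → prim (unstackStep f))

  unstack-spec : ∀ u f t rs → ⟨ unstack f ⟩ (suc (length u) * 1) (t , popping rs u)
    (λ { b (t′ , _) → b ≡ finished f u × inputPrefix (Tape.after t′) ≡ u ʳ++ inputPrefix
        (Tape.after t) })
  unstack-spec []      f t rs = loop-spec {m = 1} (prim-spec (refl , refl))
  unstack-spec (a ∷ u) f t rs = loop-spec {m = 1} (prim-spec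
    (subst (λ s → ⟨ unstack (isSep a) ⟩ _ (act (input a , left) t , s) _) (sym (popping-pop rs a u))
      (⟨⟩-mono (λ { b (t′ , _) (b≡ , t′≡) →
          b≡ , trans t′≡ (cong (λ cs → u ʳ++ inputPrefix cs)
              (after-left (tape (Tape.before t) (input a) (Tape.after t)))) }) ≤-refl
        (unstack-spec u (isSep a) (act (input a , left) t) (blank ∷ rs)))))

  firstL secondL : Lens Triple (single ⊗ single)
  firstL .Lens.get (t , s₁ , s₂)              = t , s₁
  firstL .Lens.put (t , s₁) (_ , _ , s₂)      = t , s₁ , s₂
  firstL .Lens.get-put _ _                    = refl
  firstL .Lens.put-put _ _ _                  = refl
  firstL .Lens.put-get _                      = refl
  firstL .Lens.get-map _ _                    = refl
  firstL .Lens.put-zip _ _ _ _                = refl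
  secondL .Lens.get (t , s₁ , s₂)             = t , s₂
  secondL .Lens.put (t , s₂) (_ , s₁ , _)     = t , s₁ , s₂
  secondL .Lens.get-put _ _                   = refl
  secondL .Lens.put-put _ _ _                 = refl
  secondL .Lens.put-get _                     = refl
  secondL .Lens.get-map _ _                   = refl
  secondL .Lens.put-zip _ _ _ _               = refl

  -- After unstacking, the head is one cell to the left of the result. The symbol popped last is the
  -- first one of the word: if it is a bit, the free cell receives the additional zero; if it is a
  -- separator or there was none, the head steps onto the result.
  finalMove : Bool → Cell w → Cell w × Move
  finalMove true  c = c , right
  finalMove false c = input (bit false) , stay

  conclude : Bool → Program Triple Bool
  conclude f = on fstL (prim λ c → true , finalMove f c)

  postprocess : Program Triple Bool
  postprocess = copy false >> bind bool-finite (on secondL (unstack true)) (λ _ →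
                bind bool-finite (on firstL (unstack true)) conclude)

  readTape-final : ∀ f (t : Tape w) →
    readTape (act (finalMove f (Tape.head t)) t) ≡ (if f then id else bit false ∷_)
        (inputPrefix (Tape.after t))
  readTape-final true  (tape ls c [])       = refl
  readTape-final true  (tape ls c (_ ∷ _))  = refl
  readTape-final false (tape ls c rs)       = refl

  -- The exception is genuine: for empty `x` the flag knows nothing about `z`, which might begin
  -- with a bit. In the application `z` is `afterSep x` and then empty as well.
  prependZero-finished : ∀ x z → (if finished true (reverse x) then id else bit false ∷_) (x ++ z) ≡
    prependZero (x ++ z) ⊎ x ≡ []
  prependZero-finished []      z = inj₂ refl
  prependZero-finished (a ∷ x) z rewrite unfold-reverse a x | finished-++ true (reverse x) [ a ] =
      inj₁ (go a)
    where
    go : ∀ a → (if isSep a then id else bit false ∷_) (a ∷ x ++ z) ≡ prependZero (a ∷ x ++ z)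
    go sep     = refl
    go (bit _) = refl

  doubled-finished : ∀ x → (if finished true (reverse x) then id else bit false ∷_)
      (x ++ afterSep x) ≡ doubled x
  doubled-finished x with prependZero-finished x (afterSep x)
  ... | inj₁ eq   = eq
  ... | inj₂ refl = refl

  postprocessTime : ℕ → ℕ
  postprocessTime n = suc n * 1 + (suc n * 1 + (suc n * 1 + 1))

  length-afterSep : ∀ x → length (afterSep x) ≤ length x
  length-afterSep []          = z≤n
  length-afterSep (sep ∷ x)   = n≤1+n _
  length-afterSep (bit _ ∷ x) = m≤n⇒m≤1+n (length-afterSep x)

  postprocess-spec : ∀ t → ⟨ postprocess ⟩ (postprocessTime (length (readTape t)))
      (t , emptyTape , emptyTape)
    (λ { _ (t′ , _) → readTape t′ ≡ doubled (readTape t) })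
  postprocess-spec t = >>-spec (⟨⟩-mono (λ { _ (t₁ , _ , _) (out≡ , refl , refl) →
      bind-spec {m = suc (length y) * 1} (on-spec (⟨⟩-mono (λ { _ (t₂ , _) (_ , out₂≡) →
        bind-spec {m = suc (length y) * 1} (on-spec (⟨⟩-mono (λ { f (t₃ , _) (f≡ , out₃≡) →
            on-spec (prim-spec {n = 0} (trans (readTape-final f t₃)
              (trans (cong₂ (λ g z → (if g then id else bit false ∷_) z) f≡
                (trans out₃≡ (trans (ʳ++-ʳ++ y)
                  (cong (y ++_) (trans out₂≡ (trans (cong ((afterSep y ʳ++ []) ʳ++_) out≡)
                    (trans (ʳ++-ʳ++ (afterSep y)) (++-identityʳ _))))))))
              (doubled-finished y)))) })
          (≤-reflexive (cong (λ n → suc n * 1) (length-reverse y)))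
          (unstack-spec (reverse y) true t₂ (blank ∷ [])))) })
        (*-monoˡ-≤ 1 (s≤s (≤-trans (≤-reflexive (length-reverse (afterSep y)))
            (length-afterSep y))))
        (unstack-spec (reverse (afterSep y)) true t₁ (blank ∷ [])))) })
    ≤-refl (copy-spec (Tape.head t ∷ Tape.after t) false (Tape.before t) [] []))
    where
    y = readTape t

module Compose (M : TuringMachine) where
  open TuringMachine M
  open Programs workSymbols hiding (step)
  open Embed M using (embed; embed-spec; split)
  open Doubler workSymbols

  Extended : Shape
  Extended = Standard (many extraTapes ⊗ (single ⊗ single))

  machineL : Lens Extended (Standard (many extraTapes))
  machineL .Lens.get (v , r , _)         = v , r
  machineL .Lens.put (v , r) (_ , _ , s) = v , r , s
  machineL .Lens.get-put _ _             = refl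
  machineL .Lens.put-put _ _ _           = refl
  machineL .Lens.put-get _               = refl
  machineL .Lens.get-map _ _             = refl
  machineL .Lens.put-zip _ _ _ _         = refl

  outputL : Lens Extended Triple
  outputL .Lens.get ((_ , t) , _ , s)               = t , s
  outputL .Lens.put (t , s) ((t₀ , _) , r , _)      = (t₀ , t) , r , s
  outputL .Lens.get-put _ _                         = refl
  outputL .Lens.put-put _ _ _                       = refl
  outputL .Lens.put-get _                           = refl
  outputL .Lens.get-map _ _                         = refl
  outputL .Lens.put-zip _ _ _ _                     = refl

  program : Program Extended Bool
  program = bind bool-finite (on machineL embed) (λ _ → on outputL postprocess)

  outputTape : Configuration → Tape workSymbols
  outputTape (_ , ts) = proj₂ (proj₁ (split ts))

  output-reads : ∀ c → output c ≡ readTape (outputTape c)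
  output-reads (_ , _ ∷ _ ∷ _) = refl

  after-grows : ∀ m (t : Tape workSymbols) →
      length (Tape.after (moveHead m t)) ≤ suc (length (Tape.after t))
  after-grows left  t                    = ≤-reflexive (cong length (after-left t))
  after-grows stay  t                    = n≤1+n _
  after-grows right (tape ls a [])       = z≤n
  after-grows right (tape ls a (_ ∷ rs)) = m≤n⇒m≤1+n (n≤1+n _)

  -- A step adds at most one cell to the right of the head. The output is thus bounded by the
  -- running time, and reading and rewriting it stays polynomial in the length of the input.
  output-grows : ∀ n q ts →
    length (Tape.after (outputTape (run n (q , ts)))) ≤ n + length
        (Tape.after (outputTape (q , ts)))
  output-grows zero    q ts = ≤-refl
  output-grows (suc n) q (t₀ ∷ t₁ ∷ ts) with δ q (Vec.map Tape.head (t₀ ∷ t₁ ∷ ts))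
  ... | nothing = m≤n+m _ (suc n)
  ... | just (q′ , a₀ ∷ (b , m) ∷ as) = ≤-trans (output-grows n q′ _)
    (≤-trans (+-monoʳ-≤ n (after-grows m (tape (Tape.before t₁) b (Tape.after t₁))))
        (≤-reflexive (+-suc n _)))

  length-inputPrefix : ∀ (cs : List (Cell workSymbols)) → length (inputPrefix cs) ≤ length cs
  length-inputPrefix []             = z≤n
  length-inputPrefix (blank ∷ cs)   = z≤n
  length-inputPrefix (work _ ∷ cs)  = z≤n
  length-inputPrefix (input a ∷ cs) = s≤s (length-inputPrefix cs)

  length-output : ∀ n x → length (readTape (outputTape (run n (initial x [])))) ≤ suc n
  length-output n x = ≤-trans (length-inputPrefix (Tape.head t ∷ Tape.after t))
    (s≤s (≤-trans (output-grows n start _) (≤-reflexive (+-identityʳ n))))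
    where
    t = outputTape (run n (initial x []))

  program-spec : ∀ n x → Halted (run n (initial x [])) →
    ⟨ program ⟩ (suc n + postprocessTime (suc n))
      ((loadTape x , emptyTape) , pureA (many extraTapes ⊗ (single ⊗ single)) emptyTape)
      (λ { _ ((_ , t) , _) → readTape t ≡ doubled (output (run n (initial x []))) })
  program-spec n x h = bind-spec (on-spec (embed-spec n h (on-spec (⟨⟩-mono
    (λ _ _ eq → trans eq (cong doubled (sym (output-reads (run n (initial x []))))))
    (+-mono-≤ le (+-mono-≤ le (+-monoˡ-≤ 1 le)))
    (postprocess-spec (outputTape (run n (initial x []))))))))
    where
    le : suc (length (readTape (outputTape (run n (initial x []))))) * 1 ≤ suc (suc n) * 1
    le = *-monoˡ-≤ 1 (s≤s (length-output n x))

doubled-computable : ∀ {f} → PolynomialTimeComputable f → PolynomialTimeComputable (doubled ∘ f)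
doubled-computable {f} ptc = record
  { machine  = compile program
  ; time     = (con 1 :+ time) :+ (linear :+ (linear :+ (linear :+ con 1)))
  ; halts    = λ x → proj₁ (compiled x)
  ; computes = λ x → let ts , read≡ , tapes≡ = proj₂ (compiled x) in
      trans (cong (λ v → output (proj₁ (run (⟦ time′ ⟧ (length x)) (initial x [])) , v)) tapes≡)
        (trans read≡ (cong doubled (computes x)))
  }
  where
  open PolynomialTimeComputable ptc
  open Compose machine
  open TuringMachine (compile program)
  linear time′ : Polynomial
  -- One summand of `postprocessTime` at `suc n`: the head cell makes the output up to one symbol
  -- longer than the number of steps, and the loops take one round more than there are symbols.
  linear = (con 1 :+ (con 1 :+ time)) :* con 1
  time′  = (con 1 :+ time) :+ (linear :+ (linear :+ (linear :+ con 1)))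

  compiled = λ x → compile-spec program x [] (program-spec (⟦ time ⟧ (length x)) x (halts x))

theorem7 : (K : GeometricClass) →
    NPComplete (MaximumIndependentSet K) →
    NPComplete (MaximumBipartiteSubgraph K)
theorem7 K (inNP , hard) = bipartite-inNP K inNP , λ L L∈NP →
  let f , computable , reduces = hard L L∈NP in
  doubled ∘ f , doubled-computable computable , λ x → mk⇔
    (doubled-complete K (f x) ∘ Equivalence.to (reduces x))
    (Equivalence.from (reduces x) ∘ doubled-sound K (f x))
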